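{- Let $n \in \mathbb{N}$ and let $U_n(z) := \sum_{k \in \mathbb{Z}} \frac{1}{k^n + z^n}$. At $z = e^{i\theta}$, the real and imaginary parts of $U_n(e^{i\theta})$ are given by $$\operatorname{Re}(U_n(e^{i\theta})) = \sum_{k=-\infty}^{\infty} \frac{k^n + \cos(n\theta)}{k^{2n} + 2k^n \cos(n\theta) + 1},$$ $$\operatorname{Im}(U_n(e^{i\theta})) = -\sum_{k=-\infty}^{\infty} \frac{\sin(n\theta)}{k^{2n} + 2k^n \cos(n\theta) + 1}.$$ Moreover, $$\operatorname{Re}(U_n(e^{i\theta})) + \cot(n\theta) \cdot \operatorname{Im}(U_n(e^{i\theta})) = \sum_{k=-\infty}^{\infty} \frac{k^n}{k^{2n} + 2k^n \cos(n\theta) + 1}.$$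
   Context: $\mathbb{N}$ denotes the positive integers and $\theta$ is a real angle, so that $z=e^{i\theta}$ lies on the unit circle. -}

module Defs where

open import Algebra.Bundles using (RawMonoid; RawRing; CommutativeRing)
open import Algebra.Apartness.Bundles using (HeytingField; HeytingCommutativeRing)
import Algebra.Apartness.Properties.HeytingCommutativeRing as HCR-Properties
import Algebra.Definitions.RawMonoid as RawMonoidDefs
import Algebra.Definitions.RawSemiring as RawSemiringDefs
import Algebra.Properties.AbelianGroup as AbelianGroupProperties
import Algebra.Properties.CommutativeSemigroup as CommutativeSemigroupProperties
import Algebra.Properties.Ring as RingProperties
import Algebra.Properties.Semiring.Exp as SemiringExp
import Algebra.Properties.Semiring.Mult as SemiringMult
import Algebra.Solver.Ring as RingSolver
open import Algebra.Solver.Ring.AlmostCommutativeRing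
  using (fromCommutativeRing; _-Raw-AlmostCommutative⟶_)
open import Data.Empty using (⊥-elim)
open import Data.Integer.Base as ℤ using (ℤ; +_; -[1+_])
import Data.Integer.Properties as ℤₚ
open import Data.Maybe.Base using (map)
open import Data.Nat.Base as ℕ using (ℕ; zero; suc; NonZero; _!)
import Data.Nat.Properties as ℕₚ
open import Data.Product.Base using (Σ-syntax; ∃; ∃-syntax; _×_; _,_; proj₁; proj₂)
open import Data.Sum.Base using (_⊎_; inj₁; inj₂)
open import Function.Base using (_∘_)
open import Level using (_⊔_)
open import Relation.Binary.Core using (Rel)
open import Relation.Binary.PropositionalEquality.Core as ≡ using (_≡_)
import Relation.Binary.Reasoning.Setoid as SetoidReasoning
open import Relation.Binary.Structures using (IsStrictPartialOrder)
open import Relation.Nullary.Decidable.Core using (yes; no; dec⇒maybe)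
open import Relation.Nullary.Negation.Core using (¬_)

private module ℕx = CommutativeSemigroupProperties ℕₚ.*-commutativeSemigroup

-- The real numbers, given axiomatically: a Cauchy-complete Archimedean
-- ordered field.  These axioms determine ℝ up to isomorphism.  The field is
-- a Heyting field, so x is invertible exactly when x # 0, and  x # y  means
-- x < y ⊎ y < x;  classically  _#_  is just  _≉_.
record RealNumbers c ℓ₁ ℓ₂ : Set (Level.suc (c ⊔ ℓ₁ ⊔ ℓ₂)) where
  infix 4 _<_
  field
    heytingField : HeytingField c ℓ₁ ℓ₂
  open HeytingField heytingField public

  commutativeRing : CommutativeRing c ℓ₁
  commutativeRing =
    HeytingCommutativeRing.commutativeRing heytingCommutativeRing
  open CommutativeRing commutativeRing public
    using (+-rawMonoid; ring; semiring; +-abelianGroup)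
  open RawMonoidDefs +-rawMonoid using () renaming (_×_ to _·_)

  fromℕ : ℕ → Carrier
  fromℕ n = n · 1#

  field
    _<_                  : Rel Carrier ℓ₂
    isStrictPartialOrder : IsStrictPartialOrder _≈_ _<_
    <⇒#                  : ∀ {x y} → x < y → x # y
    #⇒<⊎>                : ∀ {x y} → x # y → x < y ⊎ y < x
    +-monoˡ-<            : ∀ {x y} z → x < y → x + z < y + z
    *-pos                : ∀ {x y} → 0# < x → 0# < y → 0# < x * y
    archimedean          : ∀ x → ∃[ n ] x < fromℕ n

  infix 4 ∣_∣<_ _⟶_

  -- |x| < ε, without a function |·|.
  ∣_∣<_ : Rel Carrier ℓ₂
  ∣ x ∣< ε = - ε < x × x < ε

  _⟶_ : (ℕ → Carrier) → Carrier → Set (c ⊔ ℓ₂)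
  s ⟶ L = ∀ ε → 0# < ε → ∃[ N ] (∀ n → N ℕ.≤ n → ∣ s n - L ∣< ε)

  IsCauchy : (ℕ → Carrier) → Set (c ⊔ ℓ₂)
  IsCauchy s = ∀ ε → 0# < ε →
    ∃[ N ] (∀ m n → N ℕ.≤ m → N ℕ.≤ n → ∣ s m - s n ∣< ε)

  field
    complete : ∀ s → IsCauchy s → ∃[ L ] s ⟶ L

module _ {c ℓ} (M : RawMonoid c ℓ) where
  open RawMonoid M renaming (_∙_ to _+_; ε to 0#)

  -- Σ_{k=0}^{n-1} f k
  sum< : (ℕ → Carrier) → ℕ → Carrier
  sum< f zero    = 0#
  sum< f (suc n) = sum< f n + f n

  -- Σ_{k=-n}^{n} f k
  symmetricSum : (ℤ → Carrier) → ℕ → Carrier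
  symmetricSum f n = f (+ 0) + sum< (λ k → f (+ suc k) + f -[1+ k ]) n

module RealProperties {c ℓ₁ ℓ₂} (ℝ : RealNumbers c ℓ₁ ℓ₂) where

  open RealNumbers ℝ
  open IsStrictPartialOrder isStrictPartialOrder public
    using (<-respʳ-≈; <-respˡ-≈)
    renaming (irrefl to <-irrefl; trans to <-trans; asym to <-asym)
  open HCR-Properties heytingCommutativeRing public
    using (1#0; x-0≈x; #-congʳ; #-congˡ; x#0y#0→xy#0; invertibleʳ⇒#)
  open RingProperties ring using (-0#≈0#; -‿distribˡ-*; -‿distribʳ-*; -‿involutive)
  open AbelianGroupProperties +-abelianGroup using (⁻¹-∙-comm)
  open SemiringMult semiring using (×-homo-+; ×1-homo-*)
  open SemiringExp semiring public using (_^_)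
  open SetoidReasoning setoid

  fromℕ-+ : ∀ m n → fromℕ (m ℕ.+ n) ≈ fromℕ m + fromℕ n
  fromℕ-+ = ×-homo-+ 1#

  fromℕ-* : ∀ m n → fromℕ (m ℕ.* n) ≈ fromℕ m * fromℕ n
  fromℕ-* = ×1-homo-*

  fromℤ : ℤ → Carrier
  fromℤ (+ n)    = fromℕ n
  fromℤ -[1+ n ] = - fromℕ (suc n)

  private
    fromℤ-⊖ : ∀ m n → fromℤ (m ℤ.⊖ n) ≈ fromℕ m - fromℕ n
    fromℤ-⊖ zero    zero    = sym (-‿inverseʳ 0#)
    fromℤ-⊖ zero    (suc n) = sym (+-identityˡ _)
    fromℤ-⊖ (suc m) zero    = sym (x-0≈x _)
    fromℤ-⊖ (suc m) (suc n) = begin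
      fromℤ (suc m ℤ.⊖ suc n)           ≡⟨ ≡.cong fromℤ (ℤₚ.[1+m]⊖[1+n]≡m⊖n m n) ⟩
      fromℤ (m ℤ.⊖ n)                   ≈⟨ fromℤ-⊖ m n ⟩
      a - b                             ≈⟨ +-congʳ (+-identityˡ a) ⟨
      0# + a - b                        ≈⟨ +-congʳ (+-congʳ (-‿inverseʳ 1#)) ⟨
      1# - 1# + a - b                   ≈⟨ +-congʳ (+-assoc _ _ _) ⟩
      1# + (- 1# + a) - b               ≈⟨ +-congʳ (+-congˡ (+-comm _ _)) ⟩
      1# + (a - 1#) - b                 ≈⟨ +-congʳ (+-assoc _ _ _) ⟨
      1# + a - 1# - b                   ≈⟨ +-assoc _ _ _ ⟩
      1# + a + (- 1# - b)               ≈⟨ +-congˡ (⁻¹-∙-comm 1# b) ⟩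
      fromℕ (suc m) - fromℕ (suc n)     ∎
      where
      a = fromℕ m
      b = fromℕ n

  fromℤ-+ : ∀ i j → fromℤ (i ℤ.+ j) ≈ fromℤ i + fromℤ j
  fromℤ-+ (+ m)    (+ n)    = fromℕ-+ m n
  fromℤ-+ (+ m)    -[1+ n ] = fromℤ-⊖ m (suc n)
  fromℤ-+ -[1+ m ] (+ n)    = trans (fromℤ-⊖ n (suc m)) (+-comm _ _)
  fromℤ-+ -[1+ m ] -[1+ n ] = begin
    - fromℕ (suc (suc (m ℕ.+ n)))        ≡⟨ ≡.cong (-_ ∘ fromℕ) (≡.sym (ℕₚ.+-suc (suc m) n)) ⟩
    - fromℕ (suc m ℕ.+ suc n)            ≈⟨ -‿cong (fromℕ-+ (suc m) (suc n)) ⟩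
    - (fromℕ (suc m) + fromℕ (suc n))    ≈⟨ ⁻¹-∙-comm _ _ ⟨
    - fromℕ (suc m) - fromℕ (suc n)      ∎

  fromℤ-neg : ∀ i → fromℤ (ℤ.- i) ≈ - fromℤ i
  fromℤ-neg (+ zero)  = sym -0#≈0#
  fromℤ-neg (+ suc n) = refl
  fromℤ-neg -[1+ n ]  = sym (-‿involutive _)

  fromℤ-* : ∀ i j → fromℤ (i ℤ.* j) ≈ fromℤ i * fromℤ j
  fromℤ-* (+ m)    (+ n)    = begin
    fromℤ (+ m ℤ.* + n)   ≡⟨ ≡.cong fromℤ (ℤₚ.pos-* m n) ⟨
    fromℕ (m ℕ.* n)       ≈⟨ fromℕ-* m n ⟩
    fromℕ m * fromℕ n     ∎
  fromℤ-* (+ m)    -[1+ n ] = begin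
    fromℤ (+ m ℤ.* -[1+ n ])        ≡⟨ ≡.cong fromℤ (ℤₚ.neg-distribʳ-* (+ m) (+ suc n)) ⟨
    fromℤ (ℤ.- (+ m ℤ.* + suc n))   ≈⟨ fromℤ-neg (+ m ℤ.* + suc n) ⟩
    - fromℤ (+ m ℤ.* + suc n)       ≈⟨ -‿cong (fromℤ-* (+ m) (+ suc n)) ⟩
    - (fromℕ m * fromℕ (suc n))     ≈⟨ -‿distribʳ-* _ _ ⟩
    fromℕ m * - fromℕ (suc n)       ∎
  fromℤ-* -[1+ m ] j        = begin
    fromℤ (-[1+ m ] ℤ.* j)          ≡⟨ ≡.cong fromℤ (ℤₚ.neg-distribˡ-* (+ suc m) j) ⟨
    fromℤ (ℤ.- (+ suc m ℤ.* j))     ≈⟨ fromℤ-neg (+ suc m ℤ.* j) ⟩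
    - fromℤ (+ suc m ℤ.* j)         ≈⟨ -‿cong (pos j) ⟩
    - (fromℕ (suc m) * fromℤ j)     ≈⟨ -‿distribˡ-* _ _ ⟩
    - fromℕ (suc m) * fromℤ j       ∎
    where
    pos : ∀ j → fromℤ (+ suc m ℤ.* j) ≈ fromℕ (suc m) * fromℤ j
    pos (+ n)    = begin
      fromℤ (+ suc m ℤ.* + n)   ≡⟨ ≡.cong fromℤ (ℤₚ.pos-* (suc m) n) ⟨
      fromℕ (suc m ℕ.* n)       ≈⟨ fromℕ-* (suc m) n ⟩
      fromℕ (suc m) * fromℕ n   ∎
    pos -[1+ n ] = begin
      fromℤ (+ suc m ℤ.* -[1+ n ])        ≡⟨ ≡.cong fromℤ (ℤₚ.neg-distribʳ-* (+ suc m) (+ suc n)) ⟨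
      fromℤ (ℤ.- (+ suc m ℤ.* + suc n))   ≈⟨ fromℤ-neg (+ suc m ℤ.* + suc n) ⟩
      - fromℤ (+ suc m ℤ.* + suc n)       ≈⟨ -‿cong (pos (+ suc n)) ⟩
      - (fromℕ (suc m) * fromℕ (suc n))   ≈⟨ -‿distribʳ-* _ _ ⟩
      fromℕ (suc m) * - fromℕ (suc n)     ∎

  private
    ℤ⟶ℝ : ℤ.+-*-rawRing -Raw-AlmostCommutative⟶ fromCommutativeRing commutativeRing
    ℤ⟶ℝ = record
      { ⟦_⟧    = fromℤ
      ; +-homo = fromℤ-+
      ; *-homo = fromℤ-*
      ; -‿homo = fromℤ-neg
      ; 0-homo = refl
      ; 1-homo = +-identityʳ 1#
      }

  module Solver = RingSolver ℤ.+-*-rawRing (fromCommutativeRing commutativeRing) ℤ⟶ℝ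
    (λ i j → map (λ i≡j → reflexive (≡.cong fromℤ i≡j)) (dec⇒maybe (i ℤₚ.≟ j)))
  open Solver public using (solve; con; _:=_; _:+_; _:*_; _:-_; :-_)

  <-cotrans : ∀ {x y} → x < y → ∀ z → x < z ⊎ z < y
  <-cotrans x<y z with #-cotrans (<⇒# x<y) z
  <-cotrans x<y z | inj₁ x#z with #⇒<⊎> x#z
  ... | inj₁ x<z = inj₁ x<z
  ... | inj₂ z<x = inj₂ (<-trans z<x x<y)
  <-cotrans x<y z | inj₂ z#y with #⇒<⊎> z#y
  ... | inj₁ z<y = inj₂ z<y
  ... | inj₂ y<z = inj₁ (<-trans x<y y<z)

  <⇒0<- : ∀ {x y} → x < y → 0# < y - x
  <⇒0<- {x} {y} x<y = <-respˡ-≈ (-‿inverseʳ x) (+-monoˡ-< (- x) x<y)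

  0<-⇒< : ∀ {x y} → 0# < y - x → x < y
  0<-⇒< {x} {y} p = <-respˡ-≈ (+-identityˡ x)
    (<-respʳ-≈ (solve 2 (λ x y → y :- x :+ x := y) refl x y) (+-monoˡ-< x p))

  by-difference : ∀ {x y d} → 0# < d → d ≈ y - x → x < y
  by-difference p e = 0<-⇒< (<-respʳ-≈ e p)

  +-mono-< : ∀ {x y u v} → x < y → u < v → x + u < y + v
  +-mono-< {x} {y} {u} {v} x<y u<v = <-trans (+-monoˡ-< u x<y)
    (<-respˡ-≈ (+-comm u y) (<-respʳ-≈ (+-comm v y) (+-monoˡ-< y u<v)))

  +-pos : ∀ {x y} → 0# < x → 0# < y → 0# < x + y
  +-pos p q = <-respˡ-≈ (+-identityˡ 0#) (+-mono-< p q)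

  *-monoʳ-< : ∀ {x y} r → 0# < r → x < y → x * r < y * r
  *-monoʳ-< {x} {y} r 0<r x<y = by-difference (*-pos (<⇒0<- x<y) 0<r)
    (solve 3 (λ x y r → (y :- x) :* r := y :* r :- x :* r) refl x y r)

  half-pos : ∀ {x} → 0# < x + x → 0# < x
  half-pos {x} p with <-cotrans p x
  ... | inj₁ 0<x = 0<x
  ... | inj₂ q   = <-respʳ-≈ (solve 1 (λ x → x :+ x :- x := x) refl x) (<⇒0<- q)

  0<1 : 0# < 1#
  0<1 with #⇒<⊎> 1#0
  ... | inj₂ p = p
  ... | inj₁ p = ⊥-elim (<-asym p (<-respʳ-≈ e (*-pos q q)))
    where
    q : 0# < - 1#
    q = <-respʳ-≈ (+-identityˡ _) (<⇒0<- p)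
    e : - 1# * - 1# ≈ 1#
    e = trans (solve 1 (λ x → :- x :* :- x := x :* x) refl 1#) (*-identityˡ 1#)

  0<x² : ∀ {x} → x # 0# → 0# < x * x
  0<x² {x} x#0 with #⇒<⊎> x#0
  ... | inj₂ p = *-pos p p
  ... | inj₁ p = <-respʳ-≈ (solve 1 (λ x → :- x :* :- x := x :* x) refl x) (*-pos q q)
    where
    q : 0# < - x
    q = <-respʳ-≈ (+-identityˡ _) (<⇒0<- p)

  fromℕ-pos : ∀ n → 0# < fromℕ (suc n)
  fromℕ-pos zero    = <-respʳ-≈ (sym (+-identityʳ 1#)) 0<1
  fromℕ-pos (suc n) = +-pos 0<1 (fromℕ-pos n)

  fromℕ-mono-< : ∀ {m n} → m ℕ.< n → fromℕ m < fromℕ n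
  fromℕ-mono-< {m} m<n with ℕₚ.m≤n⇒∃[o]m+o≡n m<n
  ... | k , ≡.refl = <-respʳ-≈ e (<-respˡ-≈ (+-identityˡ _) (+-monoˡ-< (fromℕ m) (fromℕ-pos k)))
    where
    e : fromℕ (suc k) + fromℕ m ≈ fromℕ (suc m ℕ.+ k)
    e = trans (sym (fromℕ-+ (suc k) m)) (reflexive (≡.cong (fromℕ ∘ suc) (ℕₚ.+-comm k m)))

  recip : ∀ x → x # 0# → Carrier
  recip x x#0 = proj₁ (#⇒invertible x#0)

  infixl 7 _/_⟨_⟩
  _/_⟨_⟩ : Carrier → ∀ y → y # 0# → Carrier
  x / y ⟨ y#0 ⟩ = x * recip y y#0

  recip-inverseʳ : ∀ x (x#0 : x # 0#) → x * recip x x#0 ≈ 1#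
  recip-inverseʳ x x#0 =
    trans (*-congʳ (sym (x-0≈x x))) (proj₂ (proj₂ (#⇒invertible x#0)))

  x*y#0⇒x#0 : ∀ {x y} → x * y # 0# → x # 0#
  x*y#0⇒x#0 {x} {y} xy#0 = invertibleʳ⇒# (y * i , e)
    where
    i = recip (x * y) xy#0
    e : (x - 0#) * (y * i) ≈ 1#
    e = begin
      (x - 0#) * (y * i)   ≈⟨ *-congʳ (x-0≈x x) ⟩
      x * (y * i)          ≈⟨ *-assoc x y i ⟨
      x * y * i            ≈⟨ recip-inverseʳ (x * y) xy#0 ⟩
      1#                   ∎

  pos⇒# : ∀ {x} → 0# < x → x # 0#
  pos⇒# p = #-sym (<⇒# p)

  recip-pos : ∀ {x} (x#0 : x # 0#) → 0# < x → 0# < recip x x#0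
  recip-pos {x} x#0 0<x = positive (#⇒<⊎> (x*y#0⇒x#0 {y} {x}
    (#-congʳ (sym (trans (*-comm y x) (recip-inverseʳ x x#0))) 1#0)))
    where
    y = recip x x#0
    e : x * - y ≈ 0# - 1#
    e = begin
      x * - y      ≈⟨ -‿distribʳ-* _ _ ⟨
      - (x * y)    ≈⟨ -‿cong (recip-inverseʳ x x#0) ⟩
      - 1#         ≈⟨ +-identityˡ _ ⟨
      0# - 1#      ∎
    positive : y < 0# ⊎ 0# < y → 0# < y
    positive (inj₂ p) = p
    positive (inj₁ p) = ⊥-elim (<-asym 0<1 (0<-⇒< (<-respʳ-≈ e
      (*-pos 0<x (<-respʳ-≈ (+-identityˡ _) (<⇒0<- p))))))

  ¬x²<0 : ∀ {x} → ¬ (x * x < 0#)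
  ¬x²<0 p = <-asym p (0<x² (x*y#0⇒x#0 (<⇒# p)))

  0<x²+y² : ∀ {x y} → x # 0# ⊎ y # 0# → 0# < x * x + y * y
  0<x²+y² {x} {y} (inj₁ x#0) with <-cotrans (0<x² x#0) (x * x + y * y)
  ... | inj₁ p = p
  ... | inj₂ p = ⊥-elim (¬x²<0 (by-difference (<⇒0<- p)
                   (trans (solve 2 (λ x y → x :- (x :+ y) := :- y) refl (x * x) (y * y))
                          (sym (+-identityˡ _)))))
  0<x²+y² {x} {y} (inj₂ y#0) = <-respʳ-≈ (+-comm _ _) (0<x²+y² (inj₁ y#0))

  ∣∣<-resp-≈ : ∀ {x y a b} → x ≈ y → a ≈ b → ∣ x ∣< a → ∣ y ∣< b
  ∣∣<-resp-≈ x≈y a≈b (p , q) =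
    <-respˡ-≈ (-‿cong a≈b) (<-respʳ-≈ x≈y p) , <-respˡ-≈ x≈y (<-respʳ-≈ a≈b q)

  ∣∣<-weaken : ∀ {x a b} → a < b → ∣ x ∣< a → ∣ x ∣< b
  ∣∣<-weaken {x} {a} {b} a<b (p , q) = <-trans (by-difference (<⇒0<- a<b)
    (solve 2 (λ a b → b :- a := :- a :- :- b) refl a b)) p , <-trans q a<b

  ∣∣<-+ : ∀ {x y a b} → ∣ x ∣< a → ∣ y ∣< b → ∣ x + y ∣< a + b
  ∣∣<-+ {a = a} {b} (p , q) (r , s) =
    <-respˡ-≈ (⁻¹-∙-comm a b) (+-mono-< p r) , +-mono-< q s

  ∣∣<-neg : ∀ {x a} → ∣ x ∣< a → ∣ - x ∣< a
  ∣∣<-neg {x} {a} (p , q) =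
    by-difference (<⇒0<- q) (solve 2 (λ x a → a :- x := :- x :- :- a) refl x a) ,
    by-difference (<⇒0<- p) (solve 2 (λ x a → x :- :- a := a :- :- x) refl x a)

  ∣∣<-* : ∀ {x y a b} → ∣ x ∣< a → ∣ y ∣< b → ∣ x * y ∣< a * b
  ∣∣<-* {x} {y} {a} {b} (p , q) (r , s) =
    0<-⇒< (half-pos (<-respʳ-≈
      (solve 4 (λ x y a b → (x :- :- a) :* (y :- :- b) :+ (a :- x) :* (b :- y)
                         := (x :* y :- :- (a :* b)) :+ (x :* y :- :- (a :* b))) refl x y a b)
      (+-pos (*-pos (<⇒0<- p) (<⇒0<- r)) (*-pos (<⇒0<- q) (<⇒0<- s))))) ,
    0<-⇒< (half-pos (<-respʳ-≈
      (solve 4 (λ x y a b → (a :- x) :* (y :- :- b) :+ (x :- :- a) :* (b :- y)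
                         := (a :* b :- x :* y) :+ (a :* b :- x :* y)) refl x y a b)
      (+-pos (*-pos (<⇒0<- q) (<⇒0<- r)) (*-pos (<⇒0<- p) (<⇒0<- s)))))

  ∣∣<-scale : ∀ {x a r} → 0# < r → ∣ x ∣< a → ∣ x * r ∣< a * r
  ∣∣<-scale {x} {a} {r} 0<r (p , q) =
    <-respˡ-≈ (sym (-‿distribˡ-* a r)) (*-monoʳ-< r 0<r p) , *-monoʳ-< r 0<r q

  bounded : ∀ x → ∃[ N ] ∣ x ∣< fromℕ N
  bounded x with archimedean x | archimedean (- x)
  ... | m , x<m | n , -x<n = suc (m ℕ.+ n) ,
    by-difference (<⇒0<- (<-trans -x<n (fromℕ-mono-< (ℕ.s≤s (ℕₚ.m≤n+m n m)))))
      (solve 2 (λ x a → a :- :- x := x :- :- a) refl x _) ,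
    <-trans x<m (fromℕ-mono-< (ℕ.s≤s (ℕₚ.m≤m+n m n)))

  M^k≤M^M*k! : ∀ M k → M ℕ.^ k ℕ.≤ M ℕ.^ M ℕ.* k !
  M^k≤M^M*k! zero    zero    = ℕₚ.≤-refl
  M^k≤M^M*k! zero    (suc k) = ℕ.z≤n
  M^k≤M^M*k! (suc M) zero    =
    ≡.subst (1 ℕ.≤_) (≡.sym (ℕₚ.*-identityʳ _)) (ℕₚ.m^n>0 (suc M) (suc M))
  M^k≤M^M*k! M@(suc _) (suc k) with suc k ℕₚ.≤? M
  ... | yes k<M = ℕₚ.≤-trans (ℕₚ.^-monoʳ-≤ M k<M)
                    (ℕₚ.m≤m*n (M ℕ.^ M) (suc k !) {{suc k ℕₚ.!≢0}})
  ... | no  k≮M = ℕₚ.≤-trans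
    (ℕₚ.*-mono-≤ (ℕₚ.≤-trans (ℕₚ.≤-pred (ℕₚ.≰⇒> k≮M)) (ℕₚ.n≤1+n k)) (M^k≤M^M*k! M k))
    (ℕₚ.≤-reflexive (ℕx.x∙yz≈y∙xz (suc k) (M ℕ.^ M) (k !)))

  !-mono-≤ : ∀ {m n} → m ℕ.≤ n → m ! ℕ.≤ n !
  !-mono-≤ {n = n} ℕ.z≤n = ℕₚ.1≤n! n
  !-mono-≤ (ℕ.s≤s p)     = ℕₚ.*-mono-≤ (ℕ.s≤s p) (!-mono-≤ p)

  n<2^n : ∀ n → n ℕ.< 2 ℕ.^ n
  n<2^n zero    = ℕ.s≤s ℕ.z≤n
  n<2^n (suc n) = ℕₚ.≤-trans (ℕ.s≤s (n<2^n n))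
    (ℕₚ.+-mono-≤ (ℕₚ.m^n>0 2 n) (ℕₚ.≤-reflexive (≡.sym (ℕₚ.+-identityʳ _))))

  fromℕ#0 : ∀ n .{{_ : NonZero n}} → fromℕ n # 0#
  fromℕ#0 (suc n) = pos⇒# (fromℕ-pos n)

  1/_! : ℕ → Carrier
  1/ n ! = recip (fromℕ (n !)) (fromℕ#0 (n !) {{n ℕₚ.!≢0}})

  0<1/!  : ∀ n → 0# < 1/ n !
  0<1/! n = recip-pos _ (pos (n !) {{n ℕₚ.!≢0}})
    where
    pos : ∀ m .{{_ : NonZero m}} → 0# < fromℕ m
    pos (suc m) = fromℕ-pos m

  two#0 : fromℕ 2 # 0#
  two#0 = fromℕ#0 2

  h : Carrier
  h = recip (fromℕ 2) two#0

  h+h≈1 : h + h ≈ 1#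
  h+h≈1 = trans (trans
    (solve 2 (λ h x → h :+ h := (con (+ 2)) :* h) refl h h)
    refl) (recip-inverseʳ (fromℕ 2) two#0)

  0<h : 0# < h
  0<h = recip-pos two#0 (fromℕ-pos 1)

  0<h^ : ∀ k → 0# < h ^ k
  0<h^ zero    = 0<1
  0<h^ (suc k) = *-pos 0<h (0<h^ k)

  h^-halves : ∀ k → h ^ suc k + h ^ suc k ≈ h ^ k
  h^-halves k = trans (sym (distribʳ (h ^ k) h h)) (trans (*-congʳ h+h≈1) (*-identityˡ _))

  2^*h^ : ∀ k → fromℕ (2 ℕ.^ k) * h ^ k ≈ 1#
  2^*h^ zero    = trans (*-identityʳ _) (+-identityʳ 1#)
  2^*h^ (suc k) = begin
    fromℕ (2 ℕ.* 2 ℕ.^ k) * (h * h ^ k)        ≈⟨ *-congʳ (fromℕ-* 2 (2 ℕ.^ k)) ⟩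
    fromℕ 2 * fromℕ (2 ℕ.^ k) * (h * h ^ k)    ≈⟨ solve 4 (λ a b c d → a :* b :* (c :* d) := a :* c :* (b :* d)) refl _ _ _ _ ⟩
    fromℕ 2 * h * (fromℕ (2 ℕ.^ k) * h ^ k)    ≈⟨ *-cong (recip-inverseʳ _ two#0) (2^*h^ k) ⟩
    1# * 1#                                    ≈⟨ *-identityˡ 1# ⟩
    1#                                         ∎

  geometric-cauchy : ∀ (a : ℕ → Carrier) {E} → 0# < E → (∀ k → ∣ a k ∣< E * h ^ k) →
    IsCauchy (sum< +-rawMonoid a)
  geometric-cauchy a {E} 0<E bound ε 0<ε = N , λ m n N≤m N≤n → result m n N≤m N≤n
    where
    S = sum< +-rawMonoid a

    g : ℕ → Carrier
    g k = E * h ^ k + E * h ^ k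

    g-step : ∀ k → E * h ^ k + g (suc k) ≈ g k
    g-step k = +-congˡ (trans (sym (distribˡ E _ _)) (*-congˡ (h^-halves k)))

    0<g : ∀ k → 0# < g k
    0<g k = +-pos (*-pos 0<E (0<h^ k)) (*-pos 0<E (0<h^ k))

    tail : ∀ d k → ∣ S (d ℕ.+ k) - S k ∣< g k
    tail zero    k = <-respʳ-≈ (sym (-‿inverseʳ _))
        (by-difference (0<g k) (solve 1 (λ x → x := (con (+ 0)) :- :- x) refl (g k)))
      , <-respˡ-≈ (sym (-‿inverseʳ _)) (0<g k)
    tail (suc d) k = ∣∣<-resp-≈ e (g-step k) (∣∣<-+ (bound k) (tail d (suc k)))
      where
      e : a k + (S (d ℕ.+ suc k) - (S k + a k)) ≈ S (suc d ℕ.+ k) - S k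
      e = trans
        (solve 3 (λ a s t → a :+ (t :- (s :+ a)) := t :- s) refl (a k) (S k) (S (d ℕ.+ suc k)))
        (+-congʳ (reflexive (≡.cong S (ℕₚ.+-suc d k))))

    i = recip ε (pos⇒# 0<ε)

    4E : Carrier
    4E = (E + E) + (E + E)

    N = proj₁ (archimedean (4E * i))

    4E<Nε : 4E < fromℕ N * ε
    4E<Nε = <-respˡ-≈ e (*-monoʳ-< ε 0<ε (proj₂ (archimedean (4E * i))))
      where
      e : 4E * i * ε ≈ 4E
      e = trans (*-assoc _ _ _) (trans (*-congˡ (trans (*-comm i ε) (recip-inverseʳ ε _)))
            (*-identityʳ _))

    g+g<ε : g N + g N < ε
    g+g<ε = <-respˡ-≈
      (solve 2 (λ E h → ((E :+ E) :+ (E :+ E)) :* h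
                     := (E :* h :+ E :* h) :+ (E :* h :+ E :* h)) refl E (h ^ N))
      (<-trans (*-monoʳ-< (h ^ N) (0<h^ N) 4E<Nε)
        (<-respʳ-≈ e (*-monoʳ-< (h ^ N) (0<h^ N) (*-monoʳ-< ε 0<ε (fromℕ-mono-< (n<2^n N))))))
      where
      e : fromℕ (2 ℕ.^ N) * ε * h ^ N ≈ ε
      e = trans (solve 3 (λ a b c → a :* b :* c := a :* c :* b) refl _ ε (h ^ N))
            (trans (*-congʳ (2^*h^ N)) (*-identityˡ ε))

    near : ∀ m → N ℕ.≤ m → ∣ S m - S N ∣< g N
    near m N≤m = ≡.subst (λ m → ∣ S m - S N ∣< g N) (ℕₚ.m∸n+n≡m N≤m) (tail (m ℕ.∸ N) N)

    result : ∀ m n → N ℕ.≤ m → N ℕ.≤ n → ∣ S m - S n ∣< ε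
    result m n N≤m N≤n = ∣∣<-weaken g+g<ε (∣∣<-resp-≈
      (solve 3 (λ x y z → (x :- z) :+ :- (y :- z) := x :- y) refl (S m) (S n) (S N)) refl
      (∣∣<-+ (near m N≤m) (∣∣<-neg (near n N≤n))))

  exponential-cauchy : ∀ (y : ℕ → Carrier) (q : ℕ → ℕ) C B →
    (∀ k → k ℕ.≤ q k) → (∀ k → ∣ y k ∣< fromℕ (C ℕ.* B ℕ.^ k)) →
    IsCauchy (sum< +-rawMonoid (λ k → y k * 1/ q k !))
  exponential-cauchy y q C B k≤q bound = geometric-cauchy _ (fromℕ-pos (C ℕ.* M ℕ.^ M)) term
    where
    M = 2 ℕ.* B
    D = suc (C ℕ.* M ℕ.^ M)

    [2*B]^k : ∀ k → M ℕ.^ k ≡ 2 ℕ.^ k ℕ.* B ℕ.^ k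
    [2*B]^k zero    = ≡.refl
    [2*B]^k (suc k) = ≡.trans (≡.cong (M ℕ.*_) ([2*B]^k k)) (ℕx.interchange 2 B (2 ℕ.^ k) (B ℕ.^ k))

    nat : ∀ k → C ℕ.* B ℕ.^ k ℕ.* 2 ℕ.^ k ℕ.< D ℕ.* (q k) !
    nat k = ℕₚ.≤-<-trans
      (ℕₚ.≤-trans
        (ℕₚ.≤-reflexive (≡.trans (ℕₚ.*-assoc C _ _) (≡.cong (C ℕ.*_)
          (≡.trans (ℕₚ.*-comm (B ℕ.^ k) (2 ℕ.^ k)) (≡.sym ([2*B]^k k))))))
        (ℕₚ.≤-trans
          (ℕₚ.*-monoʳ-≤ C (ℕₚ.≤-trans (M^k≤M^M*k! M k) (ℕₚ.*-monoʳ-≤ (M ℕ.^ M) (!-mono-≤ (k≤q k)))))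
          (ℕₚ.≤-reflexive (≡.sym (ℕₚ.*-assoc C (M ℕ.^ M) ((q k) !))))))
      (ℕₚ.*-monoˡ-< ((q k) !) {{(q k) ℕₚ.!≢0}} (ℕₚ.n<1+n (C ℕ.* M ℕ.^ M)))

    real : ∀ k → fromℕ (C ℕ.* B ℕ.^ k) * 1/ q k ! < fromℕ D * h ^ k
    real k = <-respˡ-≈ eˡ (<-respʳ-≈ eʳ
      (*-monoʳ-< (h ^ k * 1/ q k !) (*-pos (0<h^ k) (0<1/! (q k))) (fromℕ-mono-< (nat k))))
      where
      eˡ : fromℕ (C ℕ.* B ℕ.^ k ℕ.* 2 ℕ.^ k) * (h ^ k * 1/ q k !)
         ≈ fromℕ (C ℕ.* B ℕ.^ k) * 1/ q k !
      eˡ = begin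
        fromℕ (C ℕ.* B ℕ.^ k ℕ.* 2 ℕ.^ k) * (h ^ k * 1/ q k !)
          ≈⟨ *-congʳ (fromℕ-* (C ℕ.* B ℕ.^ k) (2 ℕ.^ k)) ⟩
        fromℕ (C ℕ.* B ℕ.^ k) * fromℕ (2 ℕ.^ k) * (h ^ k * 1/ q k !)
          ≈⟨ solve 4 (λ a b c d → a :* b :* (c :* d) := a :* d :* (b :* c)) refl _ _ _ _ ⟩
        fromℕ (C ℕ.* B ℕ.^ k) * 1/ q k ! * (fromℕ (2 ℕ.^ k) * h ^ k)
          ≈⟨ *-congˡ (2^*h^ k) ⟩
        fromℕ (C ℕ.* B ℕ.^ k) * 1/ q k ! * 1#
          ≈⟨ *-identityʳ _ ⟩
        fromℕ (C ℕ.* B ℕ.^ k) * 1/ q k ! ∎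
      eʳ : fromℕ (D ℕ.* (q k) !) * (h ^ k * 1/ q k !) ≈ fromℕ D * h ^ k
      eʳ = begin
        fromℕ (D ℕ.* (q k) !) * (h ^ k * 1/ q k !)
          ≈⟨ *-congʳ (fromℕ-* D ((q k) !)) ⟩
        fromℕ D * fromℕ ((q k) !) * (h ^ k * 1/ q k !)
          ≈⟨ solve 4 (λ a b c d → a :* b :* (c :* d) := a :* c :* (b :* d)) refl _ _ _ _ ⟩
        fromℕ D * h ^ k * (fromℕ ((q k) !) * 1/ q k !)
          ≈⟨ *-congˡ (recip-inverseʳ _ _) ⟩
        fromℕ D * h ^ k * 1#
          ≈⟨ *-identityʳ _ ⟩
        fromℕ D * h ^ k ∎

    term : ∀ k → ∣ y k * 1/ q k ! ∣< fromℕ D * h ^ k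
    term k = ∣∣<-weaken (real k) (∣∣<-scale (0<1/! (q k)) (bound k))

  ∣0∣<fromℕ : ∀ n → ∣ 0# ∣< fromℕ (suc n)
  ∣0∣<fromℕ n = by-difference (fromℕ-pos n) (solve 1 (λ x → x := con (+ 0) :- :- x) refl (fromℕ (suc n))) , fromℕ-pos n

  ^-bounded : ∀ {x} N → ∣ x ∣< fromℕ N → ∀ k → ∣ x ^ k ∣< fromℕ (2 ℕ.* N ℕ.^ k)
  ^-bounded N b zero    =
    <-trans (by-difference (fromℕ-pos 1) (solve 0 ((con (+ 2)) := (con (+ 0)) :- :- (con (+ 2))) refl)) 0<1 ,
    <-respˡ-≈ (+-identityʳ 1#) (fromℕ-mono-< {1} {2} (ℕ.s≤s (ℕ.s≤s ℕ.z≤n)))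
  ^-bounded N b (suc k) = ∣∣<-resp-≈ refl
    (trans (sym (fromℕ-* N (2 ℕ.* N ℕ.^ k))) (reflexive (≡.cong fromℕ (ℕx.x∙yz≈y∙xz N 2 (N ℕ.^ k)))))
    (∣∣<-* b (^-bounded N b k))

module Trigonometry {c ℓ₁ ℓ₂} (ℝ : RealNumbers c ℓ₁ ℓ₂) where

  open RealNumbers ℝ
  open RealProperties ℝ

  cosTerm sinTerm : Carrier → ℕ → Carrier
  cosTerm x k = (- 1#) ^ k * x ^ (2 ℕ.* k) * 1/ (2 ℕ.* k) !
  sinTerm x k = (- 1#) ^ k * x ^ (2 ℕ.* k ℕ.+ 1) * 1/ (2 ℕ.* k ℕ.+ 1) !

  ∣-1^∣<2 : ∀ k → ∣ (- 1#) ^ k ∣< fromℕ 2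
  ∣-1^∣<2 zero    = ^-bounded {0#} 1 (∣0∣<fromℕ 0) 0
  ∣-1^∣<2 (suc k) = ∣∣<-resp-≈ (sym (RingProperties.-1*x≈-x ring _)) refl (∣∣<-neg (∣-1^∣<2 k))

  signed-bounded : ∀ {x} N → ∣ x ∣< fromℕ N → ∀ k m →
    ∣ (- 1#) ^ k * x ^ m ∣< fromℕ (4 ℕ.* N ℕ.^ m)
  signed-bounded N b k m = ∣∣<-resp-≈ refl
    (trans (sym (fromℕ-* 2 (2 ℕ.* N ℕ.^ m))) (reflexive (≡.cong fromℕ (≡.sym (ℕₚ.*-assoc 2 2 (N ℕ.^ m))))))
    (∣∣<-* {b = fromℕ (2 ℕ.* N ℕ.^ m)} (∣-1^∣<2 k) (^-bounded N b m))

  cos-cauchy : ∀ x → IsCauchy (sum< +-rawMonoid (cosTerm x))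
  cos-cauchy x = exponential-cauchy (λ k → (- 1#) ^ k * x ^ (2 ℕ.* k)) (2 ℕ.*_) 4 (N ℕ.^ 2)
    (λ k → ℕₚ.m≤n*m k 2)
    (λ k → ∣∣<-resp-≈ refl (reflexive (≡.cong (λ m → fromℕ (4 ℕ.* m)) (≡.sym (ℕₚ.^-*-assoc N 2 k))))
      (signed-bounded N (proj₂ (bounded x)) k (2 ℕ.* k)))
    where N = proj₁ (bounded x)

  sin-cauchy : ∀ x → IsCauchy (sum< +-rawMonoid (sinTerm x))
  sin-cauchy x = exponential-cauchy (λ k → (- 1#) ^ k * x ^ (2 ℕ.* k ℕ.+ 1)) (λ k → 2 ℕ.* k ℕ.+ 1)
    (4 ℕ.* N) (N ℕ.^ 2)
    (λ k → ℕₚ.≤-trans (ℕₚ.m≤n*m k 2) (ℕₚ.m≤m+n _ 1))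
    (λ k → ∣∣<-resp-≈ refl (reflexive (≡.cong fromℕ (e k))) (signed-bounded N (proj₂ (bounded x)) k (2 ℕ.* k ℕ.+ 1)))
    where
    N = proj₁ (bounded x)
    e : ∀ k → 4 ℕ.* N ℕ.^ (2 ℕ.* k ℕ.+ 1) ≡ 4 ℕ.* N ℕ.* (N ℕ.^ 2) ℕ.^ k
    e k = ≡.trans (≡.cong (4 ℕ.*_) (≡.trans (≡.cong (N ℕ.^_) (ℕₚ.+-comm (2 ℕ.* k) 1))
              (≡.cong (N ℕ.*_) (≡.sym (ℕₚ.^-*-assoc N 2 k)))))
            (≡.sym (ℕₚ.*-assoc 4 N _))

  -- Abstract, so that the Cauchy moduli are never unfolded.
  abstract
    cos-limit : ∀ x → ∃[ L ] sum< +-rawMonoid (cosTerm x) ⟶ L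
    cos-limit x = complete _ (cos-cauchy x)

    sin-limit : ∀ x → ∃[ L ] sum< +-rawMonoid (sinTerm x) ⟶ L
    sin-limit x = complete _ (sin-cauchy x)

  cos sin : Carrier → Carrier
  cos x = proj₁ (cos-limit x)
  sin x = proj₁ (sin-limit x)

  cot : ∀ x → sin x # 0# → Carrier
  cot x sin#0 = cos x / sin x ⟨ sin#0 ⟩

module Complex {c ℓ₁ ℓ₂} (ℝ : RealNumbers c ℓ₁ ℓ₂) where

  open RealNumbers ℝ
  open RealProperties ℝ

  infix 5 _+i_
  record ℂ : Set c where
    constructor _+i_
    field
      re im : Carrier
  open ℂ public

  ℂ-rawRing : RawRing c ℓ₁
  ℂ-rawRing = record
    { Carrier = ℂ
    ; _≈_     = λ w z → re w ≈ re z × im w ≈ im z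
    ; _+_     = λ w z → re w + re z +i im w + im z
    ; _*_     = λ w z → re w * re z - im w * im z +i re w * im z + im w * re z
    ; -_      = λ w → - re w +i - im w
    ; 0#      = 0# +i 0#
    ; 1#      = 1# +i 0#
    }
  open RawRing ℂ-rawRing public
    using ()
    renaming ( _≈_ to _≈ℂ_; _+_ to _+ℂ_; _*_ to _*ℂ_; -_ to -ℂ_; 0# to 0ℂ; 1# to 1ℂ
             ; +-rawMonoid to +ℂ-rawMonoid; rawSemiring to ℂ-rawSemiring)
  open RawSemiringDefs ℂ-rawSemiring public
    using () renaming (_^_ to _^ℂ_)

  ofℝ : Carrier → ℂ
  ofℝ x = x +i 0#

  i : ℂ
  i = 0# +i 1#

  ∣_∣² : ℂ → Carrier
  ∣ w ∣² = re w * re w + im w * im w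

  infix 4 _≠0
  _≠0 : ℂ → Set ℓ₂
  w ≠0 = re w # 0# ⊎ im w # 0#

  ∣_∣²#0 : ∀ {w} → w ≠0 → ∣ w ∣² # 0#
  ∣ w≠0 ∣²#0 = pos⇒# (0<x²+y² w≠0)

  recipℂ : ∀ w → w ≠0 → ℂ
  recipℂ w w≠0 = re w / ∣ w ∣² ⟨ ∣ w≠0 ∣²#0 ⟩ +i - im w / ∣ w ∣² ⟨ ∣ w≠0 ∣²#0 ⟩

  -- |s n - L| < ε, with both sides squared.
  infix 4 _⟶ℂ_
  _⟶ℂ_ : (ℕ → ℂ) → ℂ → Set (c ⊔ ℓ₂)
  s ⟶ℂ L = ∀ ε → 0# < ε → ∃[ N ] (∀ n → N ℕ.≤ n → ∣ s n +ℂ -ℂ L ∣² < ε * ε)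

  expTerm : ℂ → ℕ → ℂ
  expTerm w k = re (w ^ℂ k) * 1/ k ! +i im (w ^ℂ k) * 1/ k !

  ^ℂ-bounded : ∀ {w} N → ∣ re w ∣< fromℕ N → ∣ im w ∣< fromℕ N → ∀ k →
    ∣ re (w ^ℂ k) ∣< fromℕ (2 ℕ.* (2 ℕ.* N) ℕ.^ k) ×
    ∣ im (w ^ℂ k) ∣< fromℕ (2 ℕ.* (2 ℕ.* N) ℕ.^ k)
  ^ℂ-bounded N p q zero    = ^-bounded {0#} 1 (∣0∣<fromℕ 0) 0 , ∣0∣<fromℕ 1
  ^ℂ-bounded N p q (suc k) with ^ℂ-bounded N p q k
  ... | r , s = ∣∣<-resp-≈ refl e (∣∣<-+ (∣∣<-* p r) (∣∣<-neg (∣∣<-* q s)))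
              , ∣∣<-resp-≈ refl e (∣∣<-+ (∣∣<-* p s) (∣∣<-* q r))
    where
    A = 2 ℕ.* (2 ℕ.* N) ℕ.^ k
    e : fromℕ N * fromℕ A + fromℕ N * fromℕ A ≈ fromℕ (2 ℕ.* (2 ℕ.* N) ℕ.^ suc k)
    e = trans (solve 2 (λ x y → x :* y :+ x :* y := con (+ 2) :* x :* y) refl _ _)
      (trans (*-congʳ (sym (fromℕ-* 2 N))) (trans (sym (fromℕ-* (2 ℕ.* N) A))
        (reflexive (≡.cong fromℕ (ℕx.x∙yz≈y∙xz (2 ℕ.* N) 2 ((2 ℕ.* N) ℕ.^ k))))))

  exp-cauchy : ∀ w → IsCauchy (sum< +-rawMonoid (re ∘ expTerm w)) ×
                     IsCauchy (sum< +-rawMonoid (im ∘ expTerm w))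
  exp-cauchy w =
    exponential-cauchy (re ∘ (w ^ℂ_)) (λ k → k) 2 (2 ℕ.* K) (λ _ → ℕₚ.≤-refl) (proj₁ ∘ b) ,
    exponential-cauchy (im ∘ (w ^ℂ_)) (λ k → k) 2 (2 ℕ.* K) (λ _ → ℕₚ.≤-refl) (proj₂ ∘ b)
    where
    M = proj₁ (bounded (re w))
    N = proj₁ (bounded (im w))
    K = suc (M ℕ.+ N)
    b = ^ℂ-bounded {w} K (∣∣<-weaken (fromℕ-mono-< (ℕ.s≤s (ℕₚ.m≤m+n M N))) (proj₂ (bounded (re w))))
                         (∣∣<-weaken (fromℕ-mono-< (ℕ.s≤s (ℕₚ.m≤n+m N M))) (proj₂ (bounded (im w))))

  abstract
    exp-limit : ∀ w → (∃[ x ] sum< +-rawMonoid (re ∘ expTerm w) ⟶ x) ×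
                      (∃[ y ] sum< +-rawMonoid (im ∘ expTerm w) ⟶ y)
    exp-limit w = complete _ (proj₁ (exp-cauchy w)) , complete _ (proj₂ (exp-cauchy w))

  exp : ℂ → ℂ
  exp w = proj₁ (proj₁ (exp-limit w)) +i proj₁ (proj₂ (exp-limit w))

module Series {c ℓ₁ ℓ₂} (ℝ : RealNumbers c ℓ₁ ℓ₂) where

  open RealNumbers ℝ
  open RealProperties ℝ
  open Trigonometry ℝ
  open Complex ℝ

  -- Σ_{k∈ℤ} f k = S, as the limit of Σ_{k=-N}^{N} f k.  For absolutely
  -- convergent series this is the usual value, but Σ 1/(k + z) converges only
  -- in this sense.
  HasSum : (ℤ → Carrier) → Carrier → Set (c ⊔ ℓ₂)
  HasSum f S = symmetricSum +-rawMonoid f ⟶ S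

  HasSumℂ : (ℤ → ℂ) → ℂ → Set (c ⊔ ℓ₂)
  HasSumℂ f S = symmetricSum +ℂ-rawMonoid f ⟶ℂ S

  infix 9 e^i_
  e^i_ : Carrier → ℂ
  e^i θ = exp (i *ℂ ofℝ θ)

  -- Every term of U_n(z) is defined.
  NonPole : ℕ → ℂ → Set ℓ₂
  NonPole n z = ∀ k → ofℝ (fromℤ k) ^ℂ n +ℂ z ^ℂ n ≠0

  -- w = U_n(z), where U_n(z) = Σ_{k∈ℤ} 1/(kⁿ + zⁿ).
  IsU : ∀ n z → NonPole n z → ℂ → Set (c ⊔ ℓ₂)
  IsU n z nonPole w =
    HasSumℂ (λ k → recipℂ (ofℝ (fromℤ k) ^ℂ n +ℂ z ^ℂ n) (nonPole k)) w

  denominator : ℕ → Carrier → ℤ → Carrier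
  denominator n θ k =
    fromℤ k ^ (2 ℕ.* n) + fromℕ 2 * fromℤ k ^ n * cos (fromℕ n * θ) + 1#

-- Write x = kⁿ, a = cos nθ and b = sin nθ.  By de Moivre the k-th term of Uₙ is
-- the reciprocal of x + a + b i, and |x + a + b i|² = x² + 2 a x + 1 is the
-- denominator in all three sums, so the formulas hold term by term and only
-- convergence is at issue.  Since |x + a + b i| ≥ |x| − 1, every imaginary part
-- is O(k⁻²), and so is every real part when n is even (then n ≥ 2); for odd n the
-- real parts are O(k⁻²) only after the terms at k and −k have been added.
--
-- De Moivre comes from exp (w + z) = exp w exp z, that is from the Cauchy product
-- of the two exponential series, whose coefficients c satisfy
-- (m + 1) c (m + 1) = (w + z) c m.
module Submission where

open import Algebra.Bundles using (CommutativeRing; CommutativeSemiring)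
import Algebra.Properties.CommutativeSemigroup as CommutativeSemigroupProperties
import Algebra.Properties.Ring as RingProperties
import Algebra.Properties.Semiring.Exp as SemiringExp
import Algebra.Solver.Ring.NaturalCoefficients.Default as SemiringSolver
open import Algebra.Structures.Biased using (isCommutativeSemiringˡ)
open import Data.Empty using (⊥; ⊥-elim)
open import Data.Integer.Base using (ℤ; +_; -[1+_])
open import Data.Nat.Base as ℕ using (ℕ; zero; suc; NonZero; _!)
import Data.Nat.Properties as ℕₚ
open import Data.Product.Base using (Σ-syntax; ∃; ∃-syntax; _×_; _,_; proj₁; proj₂)
open import Data.Sum.Base using (_⊎_; inj₁; inj₂)
open import Function.Base using (_∘_)
open import Relation.Binary.PropositionalEquality.Core as ≡ using (_≡_; _≢_)
import Relation.Binary.Reasoning.Setoid as SetoidReasoning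
open import Relation.Binary.Structures using (IsEquivalence)
open import Relation.Nullary.Negation.Core using (¬_)
open import Defs

-- Order and equality are not decidable here, which shapes the estimates: nonnegativity is the
-- negation of x < 0, and a bound on a quotient is proved as a polynomial inequality with the
-- denominator multiplied out. The terms at k + 1 and -(k + 1) are compared with 1/k², not with 1/(k
-- + 1)²: the estimate |x + a + b i| ≥ |x| - 1 is empty at |x| = 1, where the denominator can be
-- arbitrarily small, and the factor k² makes the bound vacuous exactly there. For the Cauchy
-- product the difficulty is analytic: the triangle of products a_i b_j must be compared with the
-- square. Since k! dominates every power, an exponential series is dominated by geometric series of
-- any ratio. Ratio 1/4 is used for one factor and 1/2 for the other; with equal ratios the estimate
-- of the error would pick up a factor n.

-- Cauchy products of sequences over a commutative semiring.

module Convolution {c ℓ} (R : CommutativeSemiring c ℓ) where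

  open CommutativeSemiring R
  open SemiringSolver R using (solve; _:=_; _:+_; _:*_)
  open SetoidReasoning setoid

  ∑ : (ℕ → Carrier) → ℕ → Carrier
  ∑ = sum< +-rawMonoid

  ∑-cong : ∀ {a b} → (∀ k → a k ≈ b k) → ∀ n → ∑ a n ≈ ∑ b n
  ∑-cong a≈b zero    = refl
  ∑-cong a≈b (suc n) = +-cong (∑-cong a≈b n) (a≈b n)

  ∑-shift : ∀ a n → ∑ a (suc n) ≈ a 0 + ∑ (a ∘ suc) n
  ∑-shift a zero    = +-comm _ _
  ∑-shift a (suc n) = trans (+-congʳ (∑-shift a n)) (+-assoc _ _ _)

  -- This is Σ a_j b_{m-j} over j ≤ m. The recursion shifts `a` and leaves `b` alone, so that no
  -- index is ever subtracted.
  conv : (a b : ℕ → Carrier) → ℕ → Carrier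
  conv a b zero    = a 0 * b 0
  conv a b (suc m) = a 0 * b (suc m) + conv (a ∘ suc) b m

  conv-cong : ∀ {a a′ b b′} → (∀ k → a k ≈ a′ k) → (∀ k → b k ≈ b′ k) →
    ∀ m → conv a b m ≈ conv a′ b′ m
  conv-cong p q zero    = *-cong (p 0) (q 0)
  conv-cong p q (suc m) = +-cong (*-cong (p 0) (q (suc m))) (conv-cong (p ∘ suc) q m)

  conv-scaleˡ : ∀ w a b m → conv (λ k → w * a k) b m ≈ w * conv a b m
  conv-scaleˡ w a b zero    = *-assoc _ _ _
  conv-scaleˡ w a b (suc m) = trans
    (+-cong (*-assoc _ _ _) (conv-scaleˡ w (a ∘ suc) b m)) (sym (distribˡ _ _ _))

  conv-scaleʳ : ∀ w a b m → conv a (λ k → w * b k) m ≈ w * conv a b m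
  conv-scaleʳ w a b zero    = solve 3 (λ w x y → x :* (w :* y) := w :* (x :* y)) refl w (a 0) (b 0)
  conv-scaleʳ w a b (suc m) = trans (+-congˡ (conv-scaleʳ w (a ∘ suc) b m))
    (solve 4 (λ w x y c → x :* (w :* y) :+ w :* c := w :* (x :* y :+ c)) refl w (a 0) (b (suc m)) _)

  -- Only the last summand, a_{m+1} b_0, is lost.
  conv-shiftʳ : ∀ a {b} → b 0 ≈ 0# → ∀ m → conv a b (suc m) ≈ conv a (b ∘ suc) m
  conv-shiftʳ a e zero    = trans (+-congˡ (trans (*-congˡ e) (zeroʳ _))) (+-identityʳ _)
  conv-shiftʳ a e (suc m) = +-congˡ (conv-shiftʳ (a ∘ suc) e m)

  -- For u = v = ℕ this is the Leibniz rule for the Euler operator t d/dt on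
  -- generating functions; the weights are general so that u may be shifted.
  leibniz : ∀ {u v : ℕ → Carrier} → (∀ k → u (suc k) ≈ 1# + u k) → (∀ k → v (suc k) ≈ 1# + v k) → ∀ a b m →
    (u 0 + v m) * conv a b m ≈ conv (λ k → u k * a k) b m + conv a (λ k → v k * b k) m
  leibniz {u} {v} u-suc v-suc a b zero    =
    solve 4 (λ u v a b → (u :+ v) :* (a :* b) := u :* a :* b :+ a :* (v :* b)) refl (u 0) (v 0) (a 0) (b 0)
  leibniz {u} {v} u-suc v-suc a b (suc m) = begin
    (u 0 + v (suc m)) * (a 0 * b (suc m) + C)
      ≈⟨ distribˡ _ _ _ ⟩
    (u 0 + v (suc m)) * (a 0 * b (suc m)) + (u 0 + v (suc m)) * C
      ≈⟨ +-congˡ (*-congʳ (+-congˡ (v-suc m))) ⟩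
    (u 0 + v (suc m)) * (a 0 * b (suc m)) + (u 0 + (1# + v m)) * C
      -- The total weight is constant along an antidiagonal: u_0 + v_{m+1} = u_1 + v_m, which is the
      -- weight that the induction hypothesis asks for after `u` and `a` are shifted.
      ≈⟨ +-congˡ (*-congʳ (trans (solve 3 (λ u o v → u :+ (o :+ v) := o :+ u :+ v) refl _ _ _)
           (+-congʳ (sym (u-suc 0))))) ⟩
    (u 0 + v (suc m)) * (a 0 * b (suc m)) + (u 1 + v m) * C
      ≈⟨ +-congˡ (leibniz (u-suc ∘ suc) v-suc (a ∘ suc) b m) ⟩
    (u 0 + v (suc m)) * (a 0 * b (suc m)) + (_ + _)
      ≈⟨ solve 6 (λ u v a b x y → (u :+ v) :* (a :* b) :+ (x :+ y)
                                := (u :* a :* b :+ x) :+ (a :* (v :* b) :+ y)) refl _ _ _ _ _ _ ⟩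
    _ ∎
    where C = conv (a ∘ suc) b m

  -- With `u` the index, the recurrence says that the generating function solves y′ = w y. A product
  -- of solutions for w and z solves y′ = (w + z) y, by the Leibniz rule.
  conv-exponential : ∀ {u : ℕ → Carrier} → u 0 ≈ 0# → (∀ k → u (suc k) ≈ 1# + u k) → ∀ {w z} {a b : ℕ → Carrier} →
    (∀ k → u (suc k) * a (suc k) ≈ w * a k) → (∀ k → u (suc k) * b (suc k) ≈ z * b k) →
    ∀ m → u (suc m) * conv a b (suc m) ≈ (w + z) * conv a b m
  conv-exponential {u} u0≈0 u-suc {w} {z} {a} {b} a-rec b-rec m = begin
    u (suc m) * conv a b (suc m)
      ≈⟨ *-congʳ (trans (+-congʳ u0≈0) (+-identityˡ _)) ⟨
    (u 0 + u (suc m)) * conv a b (suc m)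
      ≈⟨ leibniz u-suc u-suc a b (suc m) ⟩
    (u 0 * a 0 * b (suc m) + conv (λ k → u (suc k) * a (suc k)) b m) + conv a (λ k → u k * b k) (suc m)
      ≈⟨ +-cong (trans (+-congʳ (trans (*-congʳ (u0x≈0 (a 0))) (zeroˡ _))) (+-identityˡ _))
                (conv-shiftʳ a (u0x≈0 (b 0)) m) ⟩
    conv (λ k → u (suc k) * a (suc k)) b m + conv a (λ k → u (suc k) * b (suc k)) m
      ≈⟨ +-cong (conv-cong a-rec (λ _ → refl) m) (conv-cong (λ _ → refl) b-rec m) ⟩
    conv (λ k → w * a k) b m + conv a (λ k → z * b k) m
      ≈⟨ +-cong (conv-scaleˡ w a b m) (conv-scaleʳ z a b m) ⟩
    w * conv a b m + z * conv a b m
      ≈⟨ distribʳ _ _ _ ⟨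
    (w + z) * conv a b m ∎
    where
    u0x≈0 : ∀ x → u 0 * x ≈ 0#
    u0x≈0 x = trans (*-congʳ u0≈0) (zeroˡ x)

  -- The row of `a 0` is split off the triangle i + j ≤ n; a triangle one size smaller remains, for
  -- the shifted `a`.
  ∑-conv : ∀ a b n → ∑ (conv a b) (suc n) ≈ a 0 * ∑ b (suc n) + ∑ (conv (a ∘ suc) b) n
  ∑-conv a b zero    = trans (+-comm _ _) (+-congʳ (*-congˡ (sym (+-identityˡ _))))
  ∑-conv a b (suc n) = trans (+-congʳ (∑-conv a b n))
    (solve 5 (λ x s c y d → (x :* s :+ c) :+ (x :* y :+ d) := x :* (s :+ y) :+ (c :+ d))
      refl (a 0) (∑ b (suc n)) (∑ (conv (a ∘ suc) b) n) (b (suc n)) (conv (a ∘ suc) b n))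

-- Limits of real sequences, geometric tails and factorial decay.

module Limits {c ℓ₁ ℓ₂} (ℝ : RealNumbers c ℓ₁ ℓ₂) where

  open RealNumbers ℝ
  open RealProperties ℝ

  recip-cancelʳ : ∀ x y (y#0 : y # 0#) → x * y * recip y y#0 ≈ x
  recip-cancelʳ x y y#0 = trans (*-assoc _ _ _) (trans (*-congˡ (recip-inverseʳ y y#0)) (*-identityʳ x))

  *-cancelʳ : ∀ {x y z} → z # 0# → x * z ≈ y * z → x ≈ y
  *-cancelʳ {x} {y} {z} z#0 e =
    trans (sym (recip-cancelʳ x z z#0)) (trans (*-congʳ e) (recip-cancelʳ y z z#0))

  ∣∣<-unscale : ∀ {x a r} → 0# < r → ∣ x * r ∣< a * r → ∣ x ∣< a
  ∣∣<-unscale 0<r p = ∣∣<-resp-≈ (recip-cancelʳ _ _ _) (recip-cancelʳ _ _ _)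
    (∣∣<-scale (recip-pos (pos⇒# 0<r) 0<r) p)

  ∣0∣< : ∀ {a} → 0# < a → ∣ 0# ∣< a
  ∣0∣< {a} 0<a = by-difference 0<a (solve 1 (λ a → a := con (+ 0) :- :- a) refl a) , 0<a

  ∣∣<⇒0< : ∀ {x a} → ∣ x ∣< a → 0# < a
  ∣∣<⇒0< {x} {a} (p , q) = half-pos (<-respʳ-≈
    (solve 2 (λ x a → (x :- :- a) :+ (a :- x) := a :+ a) refl x a) (+-pos (<⇒0<- p) (<⇒0<- q)))

  x≈h*x+h*x : ∀ x → h * x + h * x ≈ x
  x≈h*x+h*x x = trans (sym (distribʳ x h h)) (trans (*-congʳ h+h≈1) (*-identityˡ x))

  ⟶-cong : ∀ {s t L M} → (∀ n → s n ≈ t n) → L ≈ M → s ⟶ L → t ⟶ M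
  ⟶-cong s≈t L≈M s⟶L ε 0<ε with s⟶L ε 0<ε
  ... | N , p = N , λ n N≤n → ∣∣<-resp-≈ (+-cong (s≈t n) (-‿cong L≈M)) refl (p n N≤n)

  ⟶-subsequence : ∀ {s L} (q : ℕ → ℕ) → (∀ n → n ℕ.≤ q n) → s ⟶ L → s ∘ q ⟶ L
  ⟶-subsequence q n≤q s⟶L ε 0<ε with s⟶L ε 0<ε
  ... | N , p = N , λ n N≤n → p (q n) (ℕₚ.≤-trans N≤n (n≤q n))

  ⟶-const : ∀ x → (λ _ → x) ⟶ x
  ⟶-const x ε 0<ε = 0 , λ _ _ → ∣∣<-resp-≈ (sym (-‿inverseʳ x)) refl (∣0∣< 0<ε)

  ⟶-+ : ∀ {s t L M} → s ⟶ L → t ⟶ M → (λ n → s n + t n) ⟶ L + M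
  ⟶-+ {s} {t} {L} {M} s⟶L t⟶M ε 0<ε = N₁ ℕ.⊔ N₂ , λ n N≤n → ∣∣<-resp-≈
    (solve 4 (λ s t L M → (s :- L) :+ (t :- M) := (s :+ t) :- (L :+ M)) refl (s n) (t n) L M)
    (x≈h*x+h*x ε)
    (∣∣<-+ (proj₂ s-near n (ℕₚ.m⊔n≤o⇒m≤o N₁ N₂ N≤n)) (proj₂ t-near n (ℕₚ.m⊔n≤o⇒n≤o N₁ N₂ N≤n)))
    where
    s-near = s⟶L (h * ε) (*-pos 0<h 0<ε)
    t-near = t⟶M (h * ε) (*-pos 0<h 0<ε)
    N₁ = proj₁ s-near
    N₂ = proj₁ t-near

  ⟶0-* : ∀ {s t} → s ⟶ 0# → t ⟶ 0# → (λ n → s n * t n) ⟶ 0#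
  ⟶0-* {s} {t} s⟶0 t⟶0 ε 0<ε = N₁ ℕ.⊔ N₂ , λ n N≤n → ∣∣<-resp-≈
    (solve 2 (λ s t → (s :- con (+ 0)) :* (t :- con (+ 0)) := s :* t :- con (+ 0)) refl (s n) (t n))
    (*-identityˡ ε)
    (∣∣<-* (proj₂ s-near n (ℕₚ.m⊔n≤o⇒m≤o N₁ N₂ N≤n)) (proj₂ t-near n (ℕₚ.m⊔n≤o⇒n≤o N₁ N₂ N≤n)))
    where
    s-near = s⟶0 1# 0<1
    t-near = t⟶0 ε 0<ε
    N₁ = proj₁ s-near
    N₂ = proj₁ t-near

  ⟶-scale : ∀ {s L} x → s ⟶ L → (λ n → x * s n) ⟶ x * L
  ⟶-scale {s} {L} x s⟶L ε 0<ε = proj₁ s-near , λ n N≤n → ∣∣<-resp-≈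
    (solve 3 (λ x s L → x :* (s :- L) := x :* s :- x :* L) refl x (s n) L)
    (trans (sym (*-assoc _ _ _)) (trans (*-congʳ (*-comm _ _)) (recip-cancelʳ ε B _)))
    (∣∣<-* x<B (proj₂ s-near n N≤n))
    where
    B = fromℕ (proj₁ (bounded x))
    x<B = proj₂ (bounded x)
    0<B = ∣∣<⇒0< x<B
    s-near = s⟶L (ε * recip B (pos⇒# 0<B)) (*-pos 0<ε (recip-pos (pos⇒# 0<B) 0<B))

  -- Since s t = (s - L)(t - M) + L t + M (s - L), a product of null sequences and two scaled limits
  -- suffice, and no bound on a convergent sequence has to be extracted.
  ⟶-* : ∀ {s t L M} → s ⟶ L → t ⟶ M → (λ n → s n * t n) ⟶ L * M
  ⟶-* {s} {t} {L} {M} s⟶L t⟶M = ⟶-cong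
    (λ n → solve 4 (λ s t L M → (s :- L) :* (t :- M) :+ (L :* t :+ M :* (s :- L)) := s :* t)
             refl (s n) (t n) L M)
    (solve 2 (λ L M → con (+ 0) :+ (L :* M :+ M :* con (+ 0)) := L :* M) refl L M)
    (⟶-+ (⟶0-* (⟶-0 s⟶L) (⟶-0 t⟶M)) (⟶-+ (⟶-scale L t⟶M) (⟶-scale M (⟶-0 s⟶L))))
    where
    ⟶-0 : ∀ {s L} → s ⟶ L → (λ n → s n - L) ⟶ 0#
    ⟶-0 {s} {L} s⟶L = ⟶-cong (λ _ → refl) (-‿inverseʳ L) (⟶-+ s⟶L (⟶-const (- L)))

  ⟶-neg : ∀ {s L} → s ⟶ L → (λ n → - s n) ⟶ - L
  ⟶-neg {s} {L} s⟶L ε 0<ε with s⟶L ε 0<ε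
  ... | N , p = N , λ n N≤n → ∣∣<-resp-≈
    (solve 2 (λ s L → :- (s :- L) := :- s :- :- L) refl (s n) L) refl (∣∣<-neg (p n N≤n))

  -- By tightness of apartness it is enough to refute L < M. There s - s tends to L - M; at
  -- tolerance d = M - L this yields |d| < d.
  ⟶-unique : ∀ {s L M} → s ⟶ L → s ⟶ M → L ≈ M
  ⟶-unique {s} {L} {M} s⟶L s⟶M = proj₁ (tight L M) λ L#M → apart (#⇒<⊎> L#M)
    where
    ordered : ∀ {L M} → s ⟶ L → s ⟶ M → ¬ L < M
    ordered {L} {M} s⟶L s⟶M L<M = <-irrefl refl (proj₂ close)
      where
      d = M - L
      near-0 = ⟶-+ s⟶L (⟶-neg s⟶M) d (<⇒0<- L<M)
      N = proj₁ near-0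
      close : ∣ d ∣< d
      close = ∣∣<-resp-≈
        (solve 3 (λ s L M → (s :+ :- s) :- (L :+ :- M) := M :- L) refl (s N) L M) refl
        (proj₂ near-0 N ℕₚ.≤-refl)
    apart : L < M ⊎ M < L → ⊥
    apart (inj₁ p) = ordered s⟶L s⟶M p
    apart (inj₂ p) = ordered s⟶M s⟶L p

  -- The hypothesis is |s_n| < K/(n + 1) without the division; the Archimedean property at K/ε
  -- supplies the modulus.
  ⟶0-harmonic : ∀ {s K} → (∀ n → ∣ s n * fromℕ (suc n) ∣< K) → s ⟶ 0#
  ⟶0-harmonic {s} {K} bound ε 0<ε = N , λ n N≤n →
    ∣∣<-resp-≈ (sym (x-0≈x (s n))) refl (∣∣<-unscale (fromℕ-pos n)
      (∣∣<-weaken (<-trans K<Nε (<-respʳ-≈ (*-comm _ _) (*-monoʳ-< ε 0<ε (fromℕ-mono-< (ℕ.s≤s N≤n)))))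
        (bound n)))
    where
    r = recip ε (pos⇒# 0<ε)
    N = proj₁ (archimedean (K * r))
    K<Nε : K < fromℕ N * ε
    K<Nε = <-respˡ-≈ (trans (*-assoc _ _ _) (trans (*-congˡ (*-comm r ε))
      (trans (*-congˡ (recip-inverseʳ ε _)) (*-identityʳ K))))
      (*-monoʳ-< ε 0<ε (proj₂ (archimedean (K * r))))

  -- As h = 1/2, the bound 2E hᵏ is the whole infinite tail. It is uniform in `d` and reproduces
  -- itself: E hᵏ + 2E hᵏ⁺¹ = 2E hᵏ.
  geometric-tail : ∀ (a : ℕ → Carrier) {E} → 0# < E → (∀ k → ∣ a k ∣< E * h ^ k) → ∀ d k →
    ∣ sum< +-rawMonoid a (k ℕ.+ d) - sum< +-rawMonoid a k ∣< E * h ^ k + E * h ^ k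
  geometric-tail a {E} 0<E bound zero    k = ∣∣<-resp-≈
    (trans (sym (-‿inverseʳ _)) (+-congʳ (reflexive (≡.cong (sum< +-rawMonoid a) (≡.sym (ℕₚ.+-identityʳ k))))))
    refl (∣0∣< (+-pos (*-pos 0<E (0<h^ k)) (*-pos 0<E (0<h^ k))))
  geometric-tail a {E} 0<E bound (suc d) k = ∣∣<-resp-≈
    (trans
      (solve 3 (λ a s t → a :+ (t :- (s :+ a)) := t :- s) refl (a k) (sum< +-rawMonoid a k) _)
      (+-congʳ (reflexive (≡.cong (sum< +-rawMonoid a) (≡.sym (ℕₚ.+-suc k d))))))
    (+-congˡ (trans (sym (distribˡ E _ _)) (*-congˡ (h^-halves k))))
    (∣∣<-+ (bound k) (geometric-tail a 0<E bound d (suc k)))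

  fromℕ-^-inverse : ∀ {r s} → fromℕ r * s ≈ 1# → ∀ k → fromℕ (r ℕ.^ k) * s ^ k ≈ 1#
  fromℕ-^-inverse e zero    = trans (*-identityʳ _) (+-identityʳ 1#)
  fromℕ-^-inverse {r} {s} e (suc k) = trans (*-congʳ (fromℕ-* r (r ℕ.^ k))) (trans
    (solve 4 (λ a b c d → a :* b :* (c :* d) := a :* c :* (b :* d)) refl _ _ _ _)
    (trans (*-cong e (fromℕ-^-inverse e k)) (*-identityˡ 1#)))

  -- With M = r B, the inequality Mᵏ ≤ Mᴹ k! gives C Bᵏ/k! ≤ C Mᴹ/rᵏ, and `suc` makes it strict. The
  -- ratio s = 1/r is a parameter because the two factors of a Cauchy product need different ones.
  exponential-decay : ∀ (y : ℕ → Carrier) C B {r s} → fromℕ r * s ≈ 1# → 0# < s →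
    (∀ k → ∣ y k ∣< fromℕ (C ℕ.* B ℕ.^ k)) →
    ∀ k → ∣ y k * 1/ k ! ∣< fromℕ (suc (C ℕ.* (r ℕ.* B) ℕ.^ (r ℕ.* B))) * s ^ k
  exponential-decay y C B {r} {s} rs≈1 0<s bound k = ∣∣<-weaken real (∣∣<-scale (0<1/! k) (bound k))
    where
    module ℕx = CommutativeSemigroupProperties ℕₚ.*-commutativeSemigroup
    M = r ℕ.* B
    D = suc (C ℕ.* M ℕ.^ M)

    0<s^ : ∀ k → 0# < s ^ k
    0<s^ zero    = 0<1
    0<s^ (suc k) = *-pos 0<s (0<s^ k)

    M^k : ∀ k → M ℕ.^ k ≡ r ℕ.^ k ℕ.* B ℕ.^ k
    M^k zero    = ≡.refl
    M^k (suc k) = ≡.trans (≡.cong (M ℕ.*_) (M^k k)) (ℕx.interchange r B (r ℕ.^ k) (B ℕ.^ k))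

    nat : C ℕ.* B ℕ.^ k ℕ.* r ℕ.^ k ℕ.< D ℕ.* k !
    nat = begin-strict
      C ℕ.* B ℕ.^ k ℕ.* r ℕ.^ k      ≡⟨ ℕₚ.*-assoc C _ _ ⟩
      C ℕ.* (B ℕ.^ k ℕ.* r ℕ.^ k)    ≡⟨ ≡.cong (C ℕ.*_) (≡.trans (ℕₚ.*-comm (B ℕ.^ k) _) (≡.sym (M^k k))) ⟩
      C ℕ.* M ℕ.^ k                  ≤⟨ ℕₚ.*-monoʳ-≤ C (M^k≤M^M*k! M k) ⟩
      C ℕ.* (M ℕ.^ M ℕ.* k !)        ≡⟨ ℕₚ.*-assoc C _ _ ⟨
      C ℕ.* M ℕ.^ M ℕ.* k !          <⟨ ℕₚ.*-monoˡ-< (k !) {{k ℕₚ.!≢0}} (ℕₚ.n<1+n (C ℕ.* M ℕ.^ M)) ⟩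
      D ℕ.* k !                      ∎
      where open ℕₚ.≤-Reasoning

    real : fromℕ (C ℕ.* B ℕ.^ k) * 1/ k ! < fromℕ D * s ^ k
    real = <-respˡ-≈
      (trans (*-congʳ (fromℕ-* (C ℕ.* B ℕ.^ k) (r ℕ.^ k)))
        (cancel (fromℕ-^-inverse rs≈1 k)))
      (<-respʳ-≈
        (trans (*-congʳ (fromℕ-* D (k !)))
          (trans (*-congˡ (*-comm _ _)) (cancel (recip-inverseʳ _ _))))
        (*-monoʳ-< (s ^ k * 1/ k !) (*-pos (0<s^ k) (0<1/! k)) (fromℕ-mono-< nat)))
      where
      cancel : ∀ {a b c d} → b * c ≈ 1# → a * b * (c * d) ≈ a * d
      cancel {a} {b} {c} {d} e = trans
        (solve 4 (λ a b c d → a :* b :* (c :* d) := a :* d :* (b :* c)) refl a b c d)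
        (trans (*-congˡ e) (*-identityʳ _))

-- Complex arithmetic, componentwise limits and the truncated product of exponential series.

module ComplexExponential {c ℓ₁ ℓ₂} (ℝ : RealNumbers c ℓ₁ ℓ₂) where

  open RealNumbers ℝ
  open RealProperties ℝ
  open Limits ℝ
  open Complex ℝ

  1x-0y≈x : ∀ x y → 1# * x - 0# * y ≈ x
  1x-0y≈x x y = trans (+-cong (*-identityˡ x) (-‿cong (zeroˡ y))) (x-0≈x x)

  1y+0x≈y : ∀ x y → 1# * y + 0# * x ≈ y
  1y+0x≈y x y = trans (+-cong (*-identityˡ y) (zeroˡ x)) (+-identityʳ y)

  ℂ-commutativeSemiring : CommutativeSemiring c ℓ₁
  ℂ-commutativeSemiring = record
    { _≈_ = _≈ℂ_ ; _+_ = _+ℂ_ ; _*_ = _*ℂ_ ; 0# = 0ℂ ; 1# = 1ℂ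
    ; isCommutativeSemiring = isCommutativeSemiringˡ record
      { +-isCommutativeMonoid = record
        { isMonoid = record
          { isSemigroup = record
            { isMagma = record
              { isEquivalence = isEquivalenceℂ
              ; ∙-cong = λ (p , q) (r , s) → +-cong p r , +-cong q s
              }
            ; assoc = λ _ _ _ → +-assoc _ _ _ , +-assoc _ _ _
            }
          ; identity = (λ _ → +-identityˡ _ , +-identityˡ _) , (λ _ → +-identityʳ _ , +-identityʳ _)
          }
        ; comm = λ _ _ → +-comm _ _ , +-comm _ _
        }
      ; *-isCommutativeMonoid = record
        { isMonoid = record
          { isSemigroup = record
            { isMagma = record
              { isEquivalence = isEquivalenceℂ
              ; ∙-cong = λ (p , q) (r , s) →
                  +-cong (*-cong p r) (-‿cong (*-cong q s)) , +-cong (*-cong p s) (*-cong q r)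
              }
            ; assoc = λ (a +i b) (c +i d) (e +i f) →
                solve 6 (λ a b c d e f → (a :* c :- b :* d) :* e :- (a :* d :+ b :* c) :* f
                                      := a :* (c :* e :- d :* f) :- b :* (c :* f :+ d :* e)) refl a b c d e f ,
                solve 6 (λ a b c d e f → (a :* c :- b :* d) :* f :+ (a :* d :+ b :* c) :* e
                                      := a :* (c :* f :+ d :* e) :+ b :* (c :* e :- d :* f)) refl a b c d e f
            }
          ; identity = (λ (a +i b) → 1x-0y≈x a b , 1y+0x≈y a b)
                     , (λ (a +i b) → trans (proj₁ (*ℂ-comm (a +i b) 1ℂ)) (1x-0y≈x a b)
                                   , trans (proj₂ (*ℂ-comm (a +i b) 1ℂ)) (1y+0x≈y a b))
          }
        ; comm = *ℂ-comm
        }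
      ; distribʳ = λ (a +i b) (c +i d) (e +i f) →
          solve 6 (λ a b c d e f → (c :+ e) :* a :- (d :+ f) :* b
                                := (c :* a :- d :* b) :+ (e :* a :- f :* b)) refl a b c d e f ,
          solve 6 (λ a b c d e f → (c :+ e) :* b :+ (d :+ f) :* a
                                := (c :* b :+ d :* a) :+ (e :* b :+ f :* a)) refl a b c d e f
      ; zeroˡ = λ (a +i b) →
          solve 2 (λ a b → con (+ 0) :* a :- con (+ 0) :* b := con (+ 0)) refl a b ,
          solve 2 (λ a b → con (+ 0) :* b :+ con (+ 0) :* a := con (+ 0)) refl a b
      }
    }
    where
    isEquivalenceℂ : IsEquivalence _≈ℂ_
    isEquivalenceℂ = record
      { refl = refl , refl
      ; sym = λ (p , q) → sym p , sym q
      ; trans = λ (p , q) (r , s) → trans p r , trans q s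
      }
    *ℂ-comm : ∀ w z → (w *ℂ z) ≈ℂ (z *ℂ w)
    *ℂ-comm (a +i b) (c +i d) =
      solve 4 (λ a b c d → a :* c :- b :* d := c :* a :- d :* b) refl a b c d ,
      solve 4 (λ a b c d → a :* d :+ b :* c := c :* b :+ d :* a) refl a b c d

  module ℂ+* = CommutativeSemiring ℂ-commutativeSemiring
  open Convolution ℂ-commutativeSemiring

  re-∑ : ∀ a n → re (∑ a n) ≡ sum< +-rawMonoid (re ∘ a) n
  re-∑ a zero    = ≡.refl
  re-∑ a (suc n) = ≡.cong (_+ re (a n)) (re-∑ a n)

  im-∑ : ∀ a n → im (∑ a n) ≡ sum< +-rawMonoid (im ∘ a) n
  im-∑ a zero    = ≡.refl
  im-∑ a (suc n) = ≡.cong (_+ im (a n)) (im-∑ a n)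

  infix 4 ∥_∥<_ _⟶̂_
  -- A box instead of a disc: real estimates transfer part by part without square roots, at the
  -- price of a factor 2 for products.
  ∥_∥<_ : ℂ → Carrier → Set ℓ₂
  ∥ w ∥< A = ∣ re w ∣< A × ∣ im w ∣< A

  ∥∥<-resp-≈ : ∀ {w z A B} → w ≈ℂ z → A ≈ B → ∥ w ∥< A → ∥ z ∥< B
  ∥∥<-resp-≈ (p , q) e (r , s) = ∣∣<-resp-≈ p e r , ∣∣<-resp-≈ q e s

  ∥∥<-+ : ∀ {w z A B} → ∥ w ∥< A → ∥ z ∥< B → ∥ w +ℂ z ∥< A + B
  ∥∥<-+ (p , q) (r , s) = ∣∣<-+ p r , ∣∣<-+ q s

  ∥∥<-* : ∀ {w z A B} → ∥ w ∥< A → ∥ z ∥< B → ∥ w *ℂ z ∥< A * B + A * B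
  ∥∥<-* (p , q) (r , s) =
    ∣∣<-+ (∣∣<-* p r) (∣∣<-neg (∣∣<-* q s)) , ∣∣<-+ (∣∣<-* p s) (∣∣<-* q r)

  _⟶̂_ : (ℕ → ℂ) → ℂ → Set _
  s ⟶̂ L = (re ∘ s ⟶ re L) × (im ∘ s ⟶ im L)

  ⟶̂-cong : ∀ {s t L M} → (∀ n → s n ≈ℂ t n) → L ≈ℂ M → s ⟶̂ L → t ⟶̂ M
  ⟶̂-cong p (e , f) (r , s) = ⟶-cong (proj₁ ∘ p) e r , ⟶-cong (proj₂ ∘ p) f s

  ⟶̂-+ : ∀ {s t L M} → s ⟶̂ L → t ⟶̂ M → (λ n → s n +ℂ t n) ⟶̂ L +ℂ M
  ⟶̂-+ (p , q) (r , s) = ⟶-+ p r , ⟶-+ q s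

  ⟶̂-* : ∀ {s t L M} → s ⟶̂ L → t ⟶̂ M → (λ n → s n *ℂ t n) ⟶̂ L *ℂ M
  ⟶̂-* (p , q) (r , s) =
    ⟶-+ (⟶-* p r) (⟶-neg (⟶-* q s)) , ⟶-+ (⟶-* p s) (⟶-* q r)

  ⟶̂-unique : ∀ {s L M} → s ⟶̂ L → s ⟶̂ M → L ≈ℂ M
  ⟶̂-unique (p , q) (r , s) = ⟶-unique p r , ⟶-unique q s

  exp-sum : ∀ w → ∑ (expTerm w) ⟶̂ exp w
  exp-sum w =
    ⟶-cong (λ n → reflexive (≡.sym (re-∑ (expTerm w) n))) refl (proj₂ (proj₁ (exp-limit w))) ,
    ⟶-cong (λ n → reflexive (≡.sym (im-∑ (expTerm w) n))) refl (proj₂ (proj₂ (exp-limit w)))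

  1/suc! : ∀ k → fromℕ (suc k) * 1/ suc k ! ≈ 1/ k !
  1/suc! k = *-cancelʳ (fromℕ#0 (k !) {{k ℕₚ.!≢0}}) (begin
    fromℕ (suc k) * 1/ suc k ! * fromℕ (k !)   ≈⟨ solve 3 (λ a b c → a :* b :* c := a :* c :* b) refl _ _ _ ⟩
    fromℕ (suc k) * fromℕ (k !) * 1/ suc k !   ≈⟨ *-congʳ (sym (fromℕ-* (suc k) (k !))) ⟩
    fromℕ (suc k !) * 1/ suc k !               ≈⟨ recip-inverseʳ _ _ ⟩
    1#                                         ≈⟨ recip-inverseʳ _ _ ⟨
    fromℕ (k !) * 1/ k !                       ≈⟨ *-comm _ _ ⟩
    1/ k ! * fromℕ (k !)                       ∎)
    where open SetoidReasoning setoid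

  1/0!≈1 : 1/ 0 ! ≈ 1#
  1/0!≈1 = trans (sym (*-identityˡ _)) (trans (*-congʳ (sym (+-identityʳ 1#))) (recip-inverseʳ (fromℕ 1) _))

  ofℝ-* : ∀ x w → (ofℝ x *ℂ w) ≈ℂ (x * re w +i x * im w)
  ofℝ-* x w =
    solve 3 (λ x a b → x :* a :- con (+ 0) :* b := x :* a) refl x (re w) (im w) ,
    solve 3 (λ x a b → x :* b :+ con (+ 0) :* a := x :* b) refl x (re w) (im w)

  ofℝ-*-cancelˡ : ∀ {x} → x # 0# → ∀ {w z} → (ofℝ x *ℂ w) ≈ℂ (ofℝ x *ℂ z) → w ≈ℂ z
  ofℝ-*-cancelˡ {x} x#0 {w} {z} e = cancel (proj₁ e′) , cancel (proj₂ e′)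
    where
    e′ = ℂ+*.trans (ℂ+*.sym (ofℝ-* x w)) (ℂ+*.trans e (ofℝ-* x z))
    cancel : ∀ {a b} → x * a ≈ x * b → a ≈ b
    cancel p = *-cancelʳ x#0 (trans (*-comm _ _) (trans p (*-comm _ _)))

  expTerm-0 : ∀ w → expTerm w 0 ≈ℂ 1ℂ
  expTerm-0 w = trans (*-identityˡ _) 1/0!≈1 , zeroˡ _

  expTerm-suc : ∀ w k → (ofℝ (fromℕ (suc k)) *ℂ expTerm w (suc k)) ≈ℂ (w *ℂ expTerm w k)
  expTerm-suc w k = ℂ+*.trans (ofℝ-* _ (expTerm w (suc k))) (ℂ+*.trans
    (step (re (w ^ℂ suc k)) , step (im (w ^ℂ suc k)))
    ( solve 5 (λ a b x y r → (a :* x :- b :* y) :* r := a :* (x :* r) :- b :* (y :* r)) refl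
        (re w) (im w) (re (w ^ℂ k)) (im (w ^ℂ k)) (1/ k !)
    , solve 5 (λ a b x y r → (a :* y :+ b :* x) :* r := a :* (y :* r) :+ b :* (x :* r)) refl
        (re w) (im w) (re (w ^ℂ k)) (im (w ^ℂ k)) (1/ k !)))
    where
    step : ∀ x → fromℕ (suc k) * (x * 1/ suc k !) ≈ x * 1/ k !
    step x = trans (solve 3 (λ n x r → n :* (x :* r) := x :* (n :* r)) refl _ _ _) (*-congˡ (1/suc! k))

  -- Both sides start at 1 and obey the same recurrence, whose leading factor m + 1 can be
  -- cancelled. This replaces the binomial theorem.
  expTerm-+ : ∀ w z m → conv (expTerm w) (expTerm z) m ≈ℂ expTerm (w +ℂ z) m
  expTerm-+ w z zero    = ℂ+*.trans (ℂ+*.*-cong (expTerm-0 w) (expTerm-0 z))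
    (ℂ+*.trans (ℂ+*.*-identityˡ 1ℂ) (ℂ+*.sym (expTerm-0 (w +ℂ z))))
  expTerm-+ w z (suc m) = ofℝ-*-cancelˡ (fromℕ#0 (suc m)) (ℂ+*.trans
    (conv-exponential {u = ofℝ ∘ fromℕ} ℂ+*.refl (λ _ → refl , sym (+-identityˡ 0#))
      (expTerm-suc w) (expTerm-suc z) m)
    (ℂ+*.trans (ℂ+*.*-congˡ {w +ℂ z} (expTerm-+ w z m)) (ℂ+*.sym (expTerm-suc (w +ℂ z) m))))

  -- The error of the truncated Cauchy product is Σ_{j<n} a_j (B_{n+d} − B_{n−j}),
  -- B the partial sums of b.  The ratio of a is smaller than that of b, so
  -- that these terms decrease geometrically in j.
  truncation-error : ∀ {a b : ℕ → ℂ} {E G} → 0# < E → 0# < G →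
    (∀ k → ∥ a k ∥< E * (h * h) ^ k) → (∀ k → ∥ b k ∥< G * h ^ k) → ∀ n d →
    ∥ ∑ a n *ℂ ∑ b (n ℕ.+ d) +ℂ -ℂ ∑ (conv a b) n ∥< fromℕ 8 * (E * G) * h ^ n
  truncation-error {a} {b} {E} {G} 0<E 0<G a-bound b-bound zero d =
    ∥∥<-resp-≈
      ( solve 2 (λ x y → con (+ 0) := (con (+ 0) :* x :- con (+ 0) :* y) :- con (+ 0)) refl (re (∑ b d)) (im (∑ b d))
      , solve 2 (λ x y → con (+ 0) := (con (+ 0) :* y :+ con (+ 0) :* x) :- con (+ 0)) refl (re (∑ b d)) (im (∑ b d)))
      refl (∣0∣< 0<X , ∣0∣< 0<X)
    where
    0<X : 0# < fromℕ 8 * (E * G) * h ^ 0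
    0<X = *-pos (*-pos (fromℕ-pos 7) (*-pos 0<E 0<G)) 0<1
  -- The `a 0` part of the error is `a 0` times a tail of b. The rest is the error for the shifted
  -- `a`, with one term fewer of a, one more surplus term of b (hence `suc d`), and E divided by 4.
  truncation-error {a} {b} {E} {G} 0<E 0<G a-bound b-bound (suc n) d = ∥∥<-resp-≈
    (ℂ+*.trans
      (difference (a 0) (∑ (a ∘ suc) n) (∑ b (suc n ℕ.+ d)) (∑ b (suc n)) (∑ (conv (a ∘ suc) b) n))
      (ℂ+*.+-cong (ℂ+*.*-congʳ (ℂ+*.sym (∑-shift a n))) (neg-cong (ℂ+*.sym (∑-conv a b n)))))
    bound
    (∥∥<-+ (∥∥<-* (a-bound 0) tail)
      (≡.subst (λ m → ∥ ∑ (a ∘ suc) n *ℂ ∑ b m +ℂ -ℂ ∑ (conv (a ∘ suc) b) n ∥< fromℕ 8 * (E * (h * h) * G) * h ^ n)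
        (ℕₚ.+-suc n d)
        (truncation-error (*-pos 0<E (*-pos 0<h 0<h)) 0<G
          (λ k → ∥∥<-resp-≈ ℂ+*.refl (sym (*-assoc _ _ _)) (a-bound (suc k))) b-bound n (suc d))))
    where
    neg-cong : ∀ {w z} → w ≈ℂ z → (-ℂ w) ≈ℂ (-ℂ z)
    neg-cong (p , q) = -‿cong p , -‿cong q

    difference : ∀ u A B B′ C →
      (u *ℂ (B +ℂ -ℂ B′) +ℂ (A *ℂ B +ℂ -ℂ C)) ≈ℂ ((u +ℂ A) *ℂ B +ℂ -ℂ (u *ℂ B′ +ℂ C))
    difference (u +i u′) (A +i A′) (B +i B′) (D +i D′) (C +i C′) =
      solve 9 (λ u u′ A A′ B B′ D D′ C →
        (u :* (B :- D) :- u′ :* (B′ :- D′)) :+ ((A :* B :- A′ :* B′) :- C)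
        := ((u :+ A) :* B :- (u′ :+ A′) :* B′) :- ((u :* D :- u′ :* D′) :+ C)) refl u u′ A A′ B B′ D D′ C ,
      solve 9 (λ u u′ A A′ B B′ D D′ C →
        (u :* (B′ :- D′) :+ u′ :* (B :- D)) :+ ((A :* B′ :+ A′ :* B) :- C)
        := ((u :+ A) :* B′ :+ (u′ :+ A′) :* B) :- ((u :* D′ :+ u′ :* D) :+ C)) refl u u′ A A′ B B′ D D′ C′

    tail : ∥ ∑ b (suc n ℕ.+ d) +ℂ -ℂ ∑ b (suc n) ∥< G * h ^ suc n + G * h ^ suc n
    tail rewrite re-∑ b (suc n ℕ.+ d) | re-∑ b (suc n) | im-∑ b (suc n ℕ.+ d) | im-∑ b (suc n) =
      geometric-tail (re ∘ b) 0<G (proj₁ ∘ b-bound) d (suc n) ,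
      geometric-tail (im ∘ b) 0<G (proj₂ ∘ b-bound) d (suc n)

    -- The tail 2G hⁿ⁺¹ times E, doubled by the complex product, is 4EG hⁿ⁺¹. The induction
    -- hypothesis gives 8 (E/4) G hⁿ, which is 4EG hⁿ⁺¹ again; 8 is the constant that reproduces
    -- itself.
    bound : E * 1# * (G * h ^ suc n + G * h ^ suc n) + E * 1# * (G * h ^ suc n + G * h ^ suc n)
              + fromℕ 8 * (E * (h * h) * G) * h ^ n
          ≈ fromℕ 8 * (E * G) * h ^ suc n
    bound = begin
      _ ≈⟨ +-congʳ (+-cong (*-congʳ (*-identityʳ E)) (*-congʳ (*-identityʳ E))) ⟩
      _ ≈⟨ solve 4 (λ E G h H →
             (E :* (G :* (h :* H) :+ G :* (h :* H)) :+ E :* (G :* (h :* H) :+ G :* (h :* H)))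
               :+ con (+ 8) :* (E :* (h :* h) :* G) :* H
             := con (+ 4) :* (E :* G) :* (h :* H) :+ con (+ 4) :* (E :* G) :* (h :* H) :* (h :+ h))
             refl E G h (h ^ n) ⟩
      X + X * (h + h)
        ≈⟨ +-congˡ (trans (*-congˡ h+h≈1) (*-identityʳ X)) ⟩
      X + X
        ≈⟨ solve 3 (λ E G H → con (+ 4) :* (E :* G) :* H :+ con (+ 4) :* (E :* G) :* H
                            := con (+ 8) :* (E :* G) :* H) refl E G (h ^ suc n) ⟩
      _ ∎
      where
      open SetoidReasoning setoid
      X = fromℕ 4 * (E * G) * h ^ suc n

-- The addition law of exp, Euler's formula and de Moivre's formula.

module DeMoivre {c ℓ₁ ℓ₂} (ℝ : RealNumbers c ℓ₁ ℓ₂) where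

  open RealNumbers ℝ
  open RealProperties ℝ
  open Limits ℝ
  open Trigonometry ℝ
  open Complex ℝ
  open Series ℝ
  open ComplexExponential ℝ
  open Convolution ℂ-commutativeSemiring
  open RingProperties ring using (-1*x≈-x)
  private module ℂ^ = SemiringExp ℂ+*.semiring

  expTerm-decay : ∀ w {r s} → fromℕ r * s ≈ 1# → 0# < s →
    ∃[ E ] 0# < E × (∀ k → ∥ expTerm w k ∥< E * s ^ k)
  expTerm-decay w {r} rs≈1 0<s = fromℕ (suc D) , fromℕ-pos D , λ k →
    exponential-decay (re ∘ (w ^ℂ_)) 2 (2 ℕ.* K) {r} rs≈1 0<s (proj₁ ∘ ^-bound) k ,
    exponential-decay (im ∘ (w ^ℂ_)) 2 (2 ℕ.* K) {r} rs≈1 0<s (proj₂ ∘ ^-bound) k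
    where
    M = proj₁ (bounded (re w))
    N = proj₁ (bounded (im w))
    K = suc (M ℕ.+ N)
    D = 2 ℕ.* (r ℕ.* (2 ℕ.* K)) ℕ.^ (r ℕ.* (2 ℕ.* K))
    ^-bound = ^ℂ-bounded {w} K
      (∣∣<-weaken (fromℕ-mono-< (ℕ.s≤s (ℕₚ.m≤m+n M N))) (proj₂ (bounded (re w))))
      (∣∣<-weaken (fromℕ-mono-< (ℕ.s≤s (ℕₚ.m≤n+m N M))) (proj₂ (bounded (im w))))

  -- From n + 1 < 2ⁿ⁺¹ the bound K/2ⁿ becomes 2K/(n + 1).
  ⟶0-exponential : ∀ {s K} → (∀ n → ∣ s n ∣< K * h ^ n) → s ⟶ 0#
  ⟶0-exponential {s} {K} bound = ⟶0-harmonic {K = fromℕ 2 * K} λ n →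
    ∣∣<-weaken (K[n+1]/2ⁿ<2K n) (∣∣<-scale (fromℕ-pos n) (bound n))
    where
    0<K : 0# < K
    0<K = <-respʳ-≈ (*-identityʳ K) (∣∣<⇒0< (bound 0))
    K[n+1]/2ⁿ<2K : ∀ n → K * h ^ n * fromℕ (suc n) < fromℕ 2 * K
    K[n+1]/2ⁿ<2K n = <-respˡ-≈ (*-comm _ _) (<-respʳ-≈ e
      (*-monoʳ-< (K * h ^ n) (*-pos 0<K (0<h^ n)) (fromℕ-mono-< (n<2^n (suc n)))))
      where
      e : fromℕ (2 ℕ.^ suc n) * (K * h ^ n) ≈ fromℕ 2 * K
      e = trans (*-congʳ (fromℕ-* 2 (2 ℕ.^ n))) (trans
        (solve 4 (λ t p K q → t :* p :* (K :* q) := t :* K :* (p :* q)) refl _ _ _ _)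
        (trans (*-congˡ (2^*h^ n)) (*-identityʳ _)))

  -- The products `P` of partial sums tend to exp w exp z. Their distance from the partial sums `C`
  -- of the Cauchy product is the truncation error with d = 0, which tends to 0, so C = P - (P - C)
  -- has the same limit.
  exp-+ : ∀ w z → exp (w +ℂ z) ≈ℂ (exp w *ℂ exp z)
  exp-+ w z = ⟶̂-unique (exp-sum (w +ℂ z))
    (⟶̂-cong (λ n → ℂ+*.trans (truncated n) (∑-cong (expTerm-+ w z) n))
      ( solve 1 (λ x → x :+ :- con (+ 0) := x) refl _ , solve 1 (λ x → x :+ :- con (+ 0) := x) refl _)
      (⟶̂-+ (⟶̂-* (exp-sum w) (exp-sum z))
        (⟶-neg (⟶0-exponential (proj₁ ∘ error)) , ⟶-neg (⟶0-exponential (proj₂ ∘ error)))))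
    where
    h*h-inverse : fromℕ 4 * (h * h) ≈ 1#
    h*h-inverse = trans (*-congʳ (fromℕ-* 2 2)) (trans
      (solve 2 (λ t h → t :* t :* (h :* h) := t :* h :* (t :* h)) refl (fromℕ 2) h)
      (trans (*-cong (recip-inverseʳ _ two#0) (recip-inverseʳ _ two#0)) (*-identityˡ 1#)))

    -- Ratio 1/4 for the first factor and 1/2 for the second, as `truncation-error` requires.
    a = expTerm-decay w {4} h*h-inverse (*-pos 0<h 0<h)
    b = expTerm-decay z {2} (recip-inverseʳ (fromℕ 2) two#0) 0<h

    P = λ n → ∑ (expTerm w) n *ℂ ∑ (expTerm z) n
    C = ∑ (conv (expTerm w) (expTerm z))

    error : ∀ n → ∥ P n +ℂ -ℂ C n ∥< fromℕ 8 * (proj₁ a * proj₁ b) * h ^ n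
    error n = ≡.subst
      (λ m → ∥ ∑ (expTerm w) n *ℂ ∑ (expTerm z) m +ℂ -ℂ C n ∥< fromℕ 8 * (proj₁ a * proj₁ b) * h ^ n)
      (ℕₚ.+-identityʳ n)
      (truncation-error (proj₁ (proj₂ a)) (proj₁ (proj₂ b)) (proj₂ (proj₂ a)) (proj₂ (proj₂ b)) n 0)

    truncated : ∀ n → (P n +ℂ -ℂ (P n +ℂ -ℂ C n)) ≈ℂ C n
    truncated n = solve 2 (λ p c → p :- (p :- c) := c) refl (re (P n)) (re (C n))
                , solve 2 (λ p c → p :- (p :- c) := c) refl (im (P n)) (im (C n))

  -- Not automatic: `exp w` is what completeness returns for one particular Cauchy proof, so the
  -- values are compared through uniqueness of limits.
  exp-cong : ∀ {w z} → w ≈ℂ z → exp w ≈ℂ exp z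
  exp-cong {w} {z} w≈z = ⟶̂-unique (exp-sum w)
    (⟶̂-cong (∑-cong λ k → *-congʳ (proj₁ (^-cong k)) , *-congʳ (proj₂ (^-cong k))) ℂ+*.refl (exp-sum z))
    where
    ^-cong : ∀ k → (z ^ℂ k) ≈ℂ (w ^ℂ k)
    ^-cong k = ℂ^.^-congˡ k (ℂ+*.sym w≈z)

  exp-0 : exp 0ℂ ≈ℂ 1ℂ
  exp-0 = ⟶̂-unique
    (⟶̂-cong partial ℂ+*.refl
      -- The empty partial sum is 0 and not 1, so the sequence is constant only after a shift by
      -- one.
      (⟶-subsequence suc ℕₚ.n≤1+n (proj₁ (exp-sum 0ℂ)) , ⟶-subsequence suc ℕₚ.n≤1+n (proj₂ (exp-sum 0ℂ))))
    (⟶-const 1# , ⟶-const 0#)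
    where
    tail≈0 : ∀ n → ∑ (expTerm 0ℂ ∘ suc) n ≈ℂ 0ℂ
    tail≈0 zero    = ℂ+*.refl
    tail≈0 (suc n) = ℂ+*.trans (ℂ+*.+-cong (tail≈0 n)
        (trans (*-congʳ (proj₁ (ℂ+*.zeroˡ (0ℂ ^ℂ n)))) (zeroˡ _) , trans (*-congʳ (proj₂ (ℂ+*.zeroˡ (0ℂ ^ℂ n)))) (zeroˡ _)))
      (ℂ+*.+-identityˡ 0ℂ)
    partial : ∀ n → ∑ (expTerm 0ℂ) (suc n) ≈ℂ 1ℂ
    partial n = ℂ+*.trans (∑-shift (expTerm 0ℂ) n)
      (ℂ+*.trans (ℂ+*.+-cong (expTerm-0 0ℂ) (tail≈0 n)) (ℂ+*.+-identityʳ 1ℂ))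

  conj : ℂ → ℂ
  conj w = re w +i - im w

  conj-cong : ∀ {w z} → w ≈ℂ z → conj w ≈ℂ conj z
  conj-cong (p , q) = p , -‿cong q

  conj-^ : ∀ w k → (conj w ^ℂ k) ≈ℂ conj (w ^ℂ k)
  conj-^ w zero    = refl , solve 0 (con (+ 0) := :- con (+ 0)) refl
  conj-^ w (suc k) = ℂ+*.trans (ℂ+*.*-congˡ {conj w} (conj-^ w k))
    ( solve 4 (λ a b c d → a :* c :- :- b :* :- d := a :* c :- b :* d) refl (re w) (im w) (re (w ^ℂ k)) (im (w ^ℂ k))
    , solve 4 (λ a b c d → a :* :- d :+ :- b :* c := :- (a :* d :+ b :* c)) refl (re w) (im w) (re (w ^ℂ k)) (im (w ^ℂ k)))

  exp-conj : ∀ w → exp (conj w) ≈ℂ conj (exp w)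
  exp-conj w = ⟶̂-unique (exp-sum (conj w))
    (⟶̂-cong (λ n → ℂ+*.sym (partial n)) ℂ+*.refl (proj₁ (exp-sum w) , ⟶-neg (proj₂ (exp-sum w))))
    where
    partial : ∀ n → ∑ (expTerm (conj w)) n ≈ℂ conj (∑ (expTerm w) n)
    partial zero    = refl , solve 0 (con (+ 0) := :- con (+ 0)) refl
    partial (suc n) = ℂ+*.trans
      (ℂ+*.+-cong (partial n) (*-congʳ (proj₁ (conj-^ w n)) , *-congʳ (proj₂ (conj-^ w n))))
      (refl , solve 3 (λ a b r → :- a :+ :- b :* r := :- (a :+ b :* r)) refl (im (∑ (expTerm w) n)) (im (w ^ℂ n)) (1/ n !))

  imaginary-^-even : ∀ x k → ((0# +i x) ^ℂ (2 ℕ.* k)) ≈ℂ ofℝ ((- 1#) ^ k * x ^ (2 ℕ.* k))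
  imaginary-^-even x zero    = sym (*-identityˡ 1#) , refl
  imaginary-^-even x (suc k) rewrite ℕₚ.+-suc k (k ℕ.+ 0) = ℂ+*.trans
    (ℂ+*.*-congˡ {0# +i x} (ℂ+*.*-congˡ {0# +i x} (imaginary-^-even x k)))
    ( trans
        (solve 3 (λ x s p → con (+ 0) :* (con (+ 0) :* (s :* p) :- x :* con (+ 0)) :- x :* (con (+ 0) :* con (+ 0) :+ x :* (s :* p))
                         := :- s :* (x :* (x :* p))) refl x _ _)
        (*-congʳ (sym (-1*x≈-x _)))
    , solve 3 (λ x s p → con (+ 0) :* (con (+ 0) :* con (+ 0) :+ x :* (s :* p)) :+ x :* (con (+ 0) :* (s :* p) :- x :* con (+ 0))
                      := con (+ 0)) refl x ((- 1#) ^ k) (x ^ (2 ℕ.* k)))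

  imaginary-^-odd : ∀ x k → ((0# +i x) ^ℂ suc (2 ℕ.* k)) ≈ℂ (0# +i (- 1#) ^ k * x ^ suc (2 ℕ.* k))
  imaginary-^-odd x k = ℂ+*.trans (ℂ+*.*-congˡ {0# +i x} (imaginary-^-even x k))
    ( solve 3 (λ x s p → con (+ 0) :* (s :* p) :- x :* con (+ 0) := con (+ 0)) refl x ((- 1#) ^ k) (x ^ (2 ℕ.* k))
    , solve 3 (λ x s p → con (+ 0) :* con (+ 0) :+ x :* (s :* p) := s :* (x :* p)) refl x _ _)

  -- The terms of index 2k and 2k + 1 form a pair: one cosine term and i times one sine term. Hence
  -- Euler's formula compares limits along the even partial sums.
  exp-imaginary-partial : ∀ x n → ∑ (expTerm (0# +i x)) (2 ℕ.* n) ≈ℂ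
    (sum< +-rawMonoid (cosTerm x) n +i sum< +-rawMonoid (sinTerm x) n)
  exp-imaginary-partial x zero    = refl , refl
  exp-imaginary-partial x (suc n) rewrite ℕₚ.+-suc n (n ℕ.+ 0) = ℂ+*.trans
    (ℂ+*.+-cong
      (ℂ+*.+-cong (exp-imaginary-partial x n)
        (*-congʳ (proj₁ (imaginary-^-even x n)) , trans (*-congʳ (proj₂ (imaginary-^-even x n))) (zeroˡ _)))
      ( trans (*-congʳ (proj₁ (imaginary-^-odd x n))) (zeroˡ _)
      , trans (*-congʳ (proj₂ (imaginary-^-odd x n)))
          (reflexive (≡.cong (λ m → (- 1#) ^ n * x ^ m * 1/ m !) (ℕₚ.+-comm 1 (2 ℕ.* n))))))
    (+-identityʳ _ , +-congʳ (+-identityʳ _))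

  i*ofℝ : ∀ x → (i *ℂ ofℝ x) ≈ℂ (0# +i x)
  i*ofℝ x = trans (+-cong (zeroˡ x) (-‿cong (zeroʳ 1#))) (-‿inverseʳ 0#)
          , trans (+-cong (zeroˡ 0#) (*-identityˡ x)) (+-identityˡ x)

  euler : ∀ x → (e^i x) ≈ℂ (cos x +i sin x)
  euler x = ℂ+*.trans (exp-cong (i*ofℝ x)) (⟶̂-unique
    (⟶-subsequence (2 ℕ.*_) (λ n → ℕₚ.m≤n*m n 2) (proj₁ (exp-sum (0# +i x))) ,
     ⟶-subsequence (2 ℕ.*_) (λ n → ℕₚ.m≤n*m n 2) (proj₂ (exp-sum (0# +i x))))
    (⟶̂-cong (λ n → ℂ+*.sym (exp-imaginary-partial x n)) ℂ+*.refl
      (proj₂ (cos-limit x) , proj₂ (sin-limit x))))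

  e^i-0 : (e^i 0#) ≈ℂ 1ℂ
  e^i-0 = ℂ+*.trans (exp-cong (i*ofℝ 0#)) exp-0

  e^i-+ : ∀ x y → (e^i (x + y)) ≈ℂ (e^i x *ℂ e^i y)
  e^i-+ x y = ℂ+*.trans
    (exp-cong (ℂ+*.trans (i*ofℝ (x + y)) (ℂ+*.trans (sym (+-identityˡ 0#) , refl)
      (ℂ+*.sym (ℂ+*.+-cong (i*ofℝ x) (i*ofℝ y))))))
    (exp-+ (i *ℂ ofℝ x) (i *ℂ ofℝ y))

  e^i-cong : ∀ {x y} → x ≈ y → (e^i x) ≈ℂ (e^i y)
  e^i-cong x≈y = exp-cong (ℂ+*.*-congˡ {i} (x≈y , refl))

  deMoivre : ∀ x n → ((e^i x) ^ℂ n) ≈ℂ (cos (fromℕ n * x) +i sin (fromℕ n * x))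
  deMoivre x n = ℂ+*.trans (e^i-* n) (euler (fromℕ n * x))
    where
    e^i-* : ∀ n → ((e^i x) ^ℂ n) ≈ℂ (e^i (fromℕ n * x))
    e^i-* zero    = ℂ+*.trans (ℂ+*.sym e^i-0) (e^i-cong (sym (zeroˡ x)))
    e^i-* (suc n) = ℂ+*.trans (ℂ+*.*-congˡ {e^i x} (e^i-* n)) (ℂ+*.trans
      (ℂ+*.sym (e^i-+ x (fromℕ n * x)))
      (e^i-cong (sym (trans (distribʳ x 1# (fromℕ n)) (+-congʳ (*-identityˡ x))))))

  -- For w = i x, exp commutes with conjugation and w + `conj w` = 0, so |exp w|² = exp w exp
  -- (`conj w`) = exp 0 = 1.
  cos²+sin²≈1 : ∀ x → cos x * cos x + sin x * sin x ≈ 1#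
  cos²+sin²≈1 x = trans
    (solve 2 (λ c s → c :* c :+ s :* s := c :* c :- s :* :- s) refl (cos x) (sin x))
    (proj₁ (ℂ+*.trans
      (ℂ+*.sym (ℂ+*.trans (ℂ+*.*-congˡ {exp w} (exp-conj w)) (ℂ+*.*-cong exp-w (conj-cong exp-w))))
      (ℂ+*.trans (ℂ+*.sym (exp-+ w (conj w)))
        (ℂ+*.trans (exp-cong (+-identityʳ 0# , -‿inverseʳ x)) exp-0))))
    where
    w = 0# +i x
    exp-w : exp w ≈ℂ (cos x +i sin x)
    exp-w = ℂ+*.trans (exp-cong (ℂ+*.sym (i*ofℝ x))) (euler x)

-- Convergence by comparison with the sum of 1/k².

module QuadraticDecay {c ℓ₁ ℓ₂} (ℝ : RealNumbers c ℓ₁ ℓ₂) where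

  open RealNumbers ℝ
  open RealProperties ℝ
  open Limits ℝ

  -- The comparison series telescopes: |a_{k+1}| < 3C/((k + 1)(k + 2)) = 3C (1/(k + 1) - 1/(k + 2)),
  -- so every tail after a_k is below 3C/(k + 1).
  quadratic-decay⇒cauchy : ∀ (a : ℕ → Carrier) {C} →
    (∀ k → ∣ a k * (fromℕ k * fromℕ k) ∣< C) → IsCauchy (sum< +-rawMonoid a)
  quadratic-decay⇒cauchy a {C} bound ε 0<ε = suc N , λ m n N<m N<n → ∣∣<-resp-≈
    (solve 3 (λ x y z → (x :- z) :+ :- (y :- z) := x :- y) refl (S m) (S n) (S (suc N)))
    (x≈h*x+h*x ε)
    (∣∣<-+ (near m N<m) (∣∣<-neg (near n N<n)))
    where
    S = sum< +-rawMonoid a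
    3C = fromℕ 3 * C

    0<C : 0# < C
    0<C = ∣∣<⇒0< (bound 0)
    0<3C : 0# < 3C
    0<3C = *-pos (fromℕ-pos 2) 0<C

    r : ℕ → Carrier
    r k = recip (fromℕ (suc k)) (pos⇒# (fromℕ-pos k))

    0<r : ∀ k → 0# < r k
    0<r k = recip-pos _ (fromℕ-pos k)

    r-inverse : ∀ k → fromℕ (suc k) * r k ≈ 1#
    r-inverse k = recip-inverseʳ _ _

    telescope : ∀ k → r k * r (suc k) + r (suc k) ≈ r k
    telescope k = begin
      r k * r (suc k) + r (suc k)
        ≈⟨ +-congˡ (trans (*-congʳ (r-inverse k)) (*-identityˡ _)) ⟨
      r k * r (suc k) + fromℕ (suc k) * r k * r (suc k)
        ≈⟨ solve 3 (λ κ r s → r :* s :+ κ :* r :* s := (con (+ 1) :+ κ) :* s :* r) refl _ _ _ ⟩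
      (fromℕ 1 + fromℕ (suc k)) * r (suc k) * r k
        ≈⟨ *-congʳ (*-congʳ (fromℕ-+ 1 (suc k))) ⟨
      fromℕ (suc (suc k)) * r (suc k) * r k
        ≈⟨ trans (*-congʳ (r-inverse (suc k))) (*-identityˡ _) ⟩
      r k ∎
      where open SetoidReasoning setoid

    a-suc : ∀ k → ∣ a (suc k) ∣< 3C * (r k * r (suc k))
    a-suc k = ∣∣<-resp-≈ e refl (∣∣<-scale (*-pos (0<r k) (0<r (suc k))) κκ′-bound)
      where
      κ = fromℕ (suc k)
      κ′ = fromℕ (suc (suc k))
      -- The factor is 3 because k + 2 < 2 (k + 1) fails at k = 0, where both sides are 2.
      κ′<3κ : κ′ < fromℕ 3 * κ
      κ′<3κ = <-respʳ-≈ (fromℕ-* 3 (suc k)) (fromℕ-mono-<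
        (ℕ.s≤s (ℕₚ.≤-trans (ℕₚ.≤-reflexive (ℕₚ.+-comm 2 k))
          (ℕₚ.+-monoʳ-≤ k (ℕ.s≤s (ℕₚ.≤-trans (ℕ.s≤s ℕ.z≤n) (ℕₚ.m≤n+m _ k)))))))
      κκ′-bound : ∣ a (suc k) * (κ * κ′) ∣< 3C
      κκ′-bound = ∣∣<-unscale (fromℕ-pos k) (∣∣<-weaken
        (<-respˡ-≈ (*-comm _ _) (<-respʳ-≈
          (solve 3 (λ t κ C → t :* κ :* C := t :* C :* κ) refl (fromℕ 3) κ C)
          (*-monoʳ-< C 0<C κ′<3κ)))
        (∣∣<-resp-≈ (solve 3 (λ a κ κ′ → a :* (κ :* κ) :* κ′ := a :* (κ :* κ′) :* κ) refl (a (suc k)) κ κ′)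
          refl (∣∣<-scale (fromℕ-pos (suc k)) (bound (suc k)))))
      e : a (suc k) * (κ * κ′) * (r k * r (suc k)) ≈ a (suc k)
      e = trans (solve 5 (λ a x y u v → a :* (x :* y) :* (u :* v) := a :* ((x :* u) :* (y :* v))) refl _ _ _ _ _)
        (trans (*-congˡ (trans (*-cong (r-inverse k) (r-inverse (suc k))) (*-identityˡ 1#))) (*-identityʳ _))

    tail : ∀ d k → ∣ S (suc k ℕ.+ d) - S (suc k) ∣< 3C * r k
    tail zero    k = ∣∣<-resp-≈
      (trans (sym (-‿inverseʳ _)) (+-congʳ (reflexive (≡.cong S (≡.sym (ℕₚ.+-identityʳ (suc k)))))))
      refl (∣0∣< (*-pos 0<3C (0<r k)))
    tail (suc d) k = ∣∣<-resp-≈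
      (trans
        (solve 3 (λ a s t → a :+ (t :- (s :+ a)) := t :- s) refl (a (suc k)) (S (suc k)) _)
        (+-congʳ (reflexive (≡.cong S (≡.sym (ℕₚ.+-suc (suc k) d))))))
      (trans (sym (distribˡ 3C _ _)) (*-congˡ (telescope k)))
      (∣∣<-+ (a-suc k) (tail d (suc k)))

    3Cr⟶0 : (λ k → 3C * r k) ⟶ 0#
    3Cr⟶0 = ⟶0-harmonic {K = fromℕ 2 * 3C} λ n → ∣∣<-resp-≈
      (sym (trans (*-assoc _ _ _) (trans (*-congˡ (trans (*-comm _ _) (r-inverse n))) (*-identityʳ 3C))))
      refl
      ( by-difference (*-pos (fromℕ-pos 2) 0<3C)
          (solve 1 (λ x → con (+ 3) :* x := x :- :- (con (+ 2) :* x)) refl 3C)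
      , by-difference 0<3C (solve 1 (λ x → x := con (+ 2) :* x :- x) refl 3C))

    small = 3Cr⟶0 (h * ε) (*-pos 0<h 0<ε)
    N = proj₁ small

    near : ∀ m → suc N ℕ.≤ m → ∣ S m - S (suc N) ∣< h * ε
    near m N<m = ≡.subst (λ m → ∣ S m - S (suc N) ∣< h * ε) (ℕₚ.m+[n∸m]≡n N<m)
      (∣∣<-weaken (<-respˡ-≈ (x-0≈x _) (proj₂ (proj₂ small N ℕₚ.≤-refl))) (tail (m ℕ.∸ suc N) N))

-- Estimates for the real and imaginary parts of 1/(x + a + b i) with a² + b² = 1.

module Circle {c ℓ₁ ℓ₂} (ℝ : RealNumbers c ℓ₁ ℓ₂) where

  open RealNumbers ℝ
  open RealProperties ℝ
  open Limits ℝ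

  infix 4 0≤_
  -- The negative form applies to squares, for which the choice between 0 < x and x ≈ 0 cannot be
  -- made. Strictness is regained by adding a positive number, as in `<-0≤-+`.
  0≤_ : Carrier → Set ℓ₂
  0≤ x = ¬ x < 0#

  0≤-resp-≈ : ∀ {x y} → x ≈ y → 0≤ x → 0≤ y
  0≤-resp-≈ e 0≤x y<0 = 0≤x (<-respˡ-≈ (sym e) y<0)

  <⇒0≤ : ∀ {x} → 0# < x → 0≤ x
  <⇒0≤ 0<x x<0 = <-asym 0<x x<0

  0≤-+ : ∀ {x y} → 0≤ x → 0≤ y → 0≤ x + y
  0≤-+ {x} {y} 0≤x 0≤y p with <-cotrans p y
  ... | inj₁ x+y<y = 0≤x (by-difference (<⇒0<- x+y<y)
    (solve 2 (λ x y → y :- (x :+ y) := con (+ 0) :- x) refl x y))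
  ... | inj₂ y<0   = 0≤y y<0

  <-0≤-+ : ∀ {x y} → 0# < x → 0≤ y → 0# < x + y
  <-0≤-+ {x} {y} 0<x 0≤y with <-cotrans 0<x (x + y)
  ... | inj₁ p = p
  ... | inj₂ p = ⊥-elim (0≤y (by-difference (<⇒0<- p)
    (solve 2 (λ x y → x :- (x :+ y) := con (+ 0) :- y) refl x y)))

  -- If x y < 0, then both factors are apart from 0, and only then do their signs become available
  -- for case analysis.
  0≤-* : ∀ {x y} → 0≤ x → 0≤ y → 0≤ x * y
  0≤-* {x} {y} 0≤x 0≤y xy<0 with #⇒<⊎> (x*y#0⇒x#0 (<⇒# xy<0))
                               | #⇒<⊎> (x*y#0⇒x#0 (#-congʳ (*-comm x y) (<⇒# xy<0)))
  ... | inj₁ x<0 | _        = 0≤x x<0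
  ... | inj₂ _   | inj₁ y<0 = 0≤y y<0
  ... | inj₂ 0<x | inj₂ 0<y = <-asym xy<0 (*-pos 0<x 0<y)

  0≤fromℕ : ∀ n → 0≤ fromℕ n
  0≤fromℕ zero    = <-irrefl refl
  0≤fromℕ (suc n) = <⇒0≤ (fromℕ-pos n)

  0≤⇒pos : ∀ {x} → 0≤ x → x # 0# → 0# < x
  0≤⇒pos 0≤x x#0 with #⇒<⊎> x#0
  ... | inj₁ x<0 = ⊥-elim (0≤x x<0)
  ... | inj₂ 0<x = 0<x

  -- Here y stands for N/D, known only through y D = N. The last two hypotheses are |N t| < C D, so
  -- that every estimate below reduces to a polynomial inequality.
  quotient-bound : ∀ {y D N t C} → 0# < D → y * D ≈ N →
    0# < C * D + N * t → 0# < C * D - N * t → ∣ y * t ∣< C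
  quotient-bound {y} {D} {N} {t} {C} 0<D e p q = ∣∣<-unscale 0<D
    ( by-difference (<-respʳ-≈ (+-congˡ (*-congʳ (sym e))) p)
        (solve 4 (λ y D t C → C :* D :+ y :* D :* t := y :* t :* D :- :- (C :* D)) refl y D t C)
    , by-difference (<-respʳ-≈ (+-congˡ (-‿cong (*-congʳ (sym e)))) q)
        (solve 4 (λ y D t C → C :* D :- y :* D :* t := C :* D :- y :* t :* D) refl y D t C))

  UnitVector : Carrier → Carrier → Set ℓ₁
  UnitVector a b = a * a + b * b ≈ fromℕ 1

  -- |x + a + b i|²
  distance² : (a b x : Carrier) → Carrier
  distance² a b x = (x + a) * (x + a) + b * b

  distance²-cong : ∀ {a b x y} → x ≈ y → distance² a b x ≈ distance² a b y
  distance²-cong e = +-congʳ (*-cong (+-congʳ e) (+-congʳ e))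

  -- Together with `reflect` this lets bounds proved for x ≥ 0 serve at -x as well.
  distance²-neg : ∀ a b x → distance² a b (- x) ≈ distance² (- a) b x
  distance²-neg = solve 3 (λ a b x → (:- x :+ a) :* (:- x :+ a) :+ b :* b
                                  := (x :+ :- a) :* (x :+ :- a) :+ b :* b) refl

  reflect : ∀ {a b} → UnitVector a b → UnitVector (- a) b
  reflect {a} {b} unit = trans (solve 2 (λ a b → :- a :* :- a :+ b :* b := a :* a :+ b :* b) refl a b) unit

  -- If p = a - 1 were positive, then p² + 2p = a² - 1 = -b² would be positive too.
  0≤1-a : ∀ {a b} → UnitVector a b → 0≤ fromℕ 1 - a
  0≤1-a {a} {b} unit 1-a<0 = ¬x²<0 (by-difference
    (+-pos (*-pos 0<p 0<p) (+-pos 0<p 0<p))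
    (trans
      (solve 2 (λ a b → (con (+ 0) :- (con (+ 1) :- a)) :* (con (+ 0) :- (con (+ 1) :- a))
                          :+ ((con (+ 0) :- (con (+ 1) :- a)) :+ (con (+ 0) :- (con (+ 1) :- a)))
                      := (con (+ 0) :- b :* b) :+ ((a :* a :+ b :* b) :- con (+ 1))) refl a b)
      (trans (+-congˡ (trans (+-congʳ unit) (-‿inverseʳ (fromℕ 1)))) (+-identityʳ _))))
    where
    0<p : 0# < 0# - (fromℕ 1 - a)
    0<p = <⇒0<- 1-a<0

  0≤1+a : ∀ {a b} → UnitVector a b → 0≤ fromℕ 1 + a
  0≤1+a {a} unit = 0≤-resp-≈ (solve 1 (λ a → con (+ 1) :- :- a := con (+ 1) :+ a) refl a) (0≤1-a (reflect unit))

  module _ {a b} (unit : UnitVector a b) where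

    unit′ : UnitVector b a
    unit′ = trans (+-comm _ _) unit

    distance²-expand : ∀ x → distance² a b x ≈ x * x + fromℕ 2 * x * a + fromℕ 1
    distance²-expand x = trans
      (solve 3 (λ x a b → (x :+ a) :* (x :+ a) :+ b :* b
                       := (x :* x :+ con (+ 2) :* x :* a) :+ (a :* a :+ b :* b)) refl x a b)
      (+-congˡ unit)

    -- The difference is 2x (1 + a). This is the reverse triangle inequality, squared.
    [x-1]²≤distance² : ∀ {x} → 0≤ x → 0≤ distance² a b x - (x - fromℕ 1) * (x - fromℕ 1)
    [x-1]²≤distance² {x} 0≤x = 0≤-resp-≈
      (trans (solve 2 (λ x a → (x :+ x) :* (con (+ 1) :+ a)
                            := (x :* x :+ con (+ 2) :* x :* a :+ con (+ 1)) :- (x :- con (+ 1)) :* (x :- con (+ 1))) refl x a)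
        (+-congʳ (sym (distance²-expand x))))
      (0≤-* (0≤-+ 0≤x 0≤x) (0≤1+a unit))

    -- This encodes κ ≤ x - 1 with explicit slack `e`. It is applied with x = (k + 1)ⁿ and κ = k.
    module _ {x κ e} (0≤κ : 0≤ κ) (0≤e : 0≤ e) (x≈1+κ+e : x ≈ fromℕ 1 + κ + e) where

      0≤x : 0≤ x
      0≤x = 0≤-resp-≈ (sym x≈1+κ+e) (0≤-+ (0≤-+ (0≤fromℕ 1) 0≤κ) 0≤e)

      x-1≈κ+e : x - fromℕ 1 ≈ κ + e
      x-1≈κ+e = trans (+-congʳ x≈1+κ+e)
        (solve 2 (λ κ e → con (+ 1) :+ κ :+ e :- con (+ 1) := κ :+ e) refl κ e)

      κ²≤distance² : 0≤ distance² a b x - κ * κ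
      κ²≤distance² = 0≤-resp-≈
        (trans (+-congˡ (solve 2 (λ κ e → e :* (κ :+ κ :+ e) := (κ :+ e) :* (κ :+ e) :- κ :* κ) refl κ e))
          (trans (+-congʳ (+-congˡ (-‿cong (*-cong x-1≈κ+e x-1≈κ+e))))
            (solve 3 (λ D p k → (D :- p) :+ (p :- k) := D :- k) refl _ _ _)))
        (0≤-+ ([x-1]²≤distance² 0≤x) (0≤-* 0≤e (0≤-+ (0≤-+ 0≤κ 0≤κ) 0≤e)))

      0≤κ² : 0≤ κ * κ
      0≤κ² = 0≤-* 0≤κ 0≤κ

      -- From |b| ≤ 1 and κ² ≤ D one gets |b| κ² ≤ D; a second D > 0 makes the inequality strict.
      imaginary-bound : ∀ {y D} → D ≈ distance² a b x → 0# < D → y * D ≈ b → ∣ y * (κ * κ) ∣< fromℕ 2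
      imaginary-bound {y} {D} D≈ 0<D yD≈b = quotient-bound 0<D yD≈b
        (<-respʳ-≈ (solve 3 (λ D k b → D :+ ((D :- k) :+ (con (+ 1) :+ b) :* k) := con (+ 2) :* D :+ b :* k) refl D (κ * κ) b)
          (<-0≤-+ 0<D (0≤-+ κ²≤D (0≤-* (0≤1+a unit′) 0≤κ²))))
        (<-respʳ-≈ (solve 3 (λ D k b → D :+ ((D :- k) :+ (con (+ 1) :- b) :* k) := con (+ 2) :* D :- b :* k) refl D (κ * κ) b)
          (<-0≤-+ 0<D (0≤-+ κ²≤D (0≤-* (0≤1-a unit′) 0≤κ²))))
        where
        κ²≤D : 0≤ D - κ * κ
        κ²≤D = 0≤-resp-≈ (+-congʳ (sym D≈)) κ²≤distance²

      -- The case κ² ≤ x - 1. Then (x - 1) κ² ≤ (x - 1)² ≤ D and 2κ² ≤ 2D, so |x + a| κ² ≤ (x + 1)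
      -- κ² ≤ 3D; the fourth D gives strictness.
      real-bound : ∀ {f} → 0≤ f → x ≈ fromℕ 1 + κ * κ + f →
        ∀ {y D} → D ≈ distance² a b x → 0# < D → y * D ≈ x + a → ∣ y * (κ * κ) ∣< fromℕ 4
      real-bound {f} 0≤f x≈1+κ²+f {y} {D} D≈ 0<D yD≈ = quotient-bound 0<D yD≈
        (<-respʳ-≈
          (solve 4 (λ D x a k →
             D :+ (((D :- (x :- con (+ 1)) :* k) :+ ((D :- k) :+ (D :- k)))
                   :+ ((x :+ con (+ 1)) :* k :+ (x :+ a) :* k))
             := con (+ 4) :* D :+ (x :+ a) :* k) refl D x a (κ * κ))
          (<-0≤-+ 0<D (0≤-+ [x+1]κ²≤3D (0≤-resp-≈
            (solve 3 (λ x a k → (x :+ x :+ (con (+ 1) :+ a)) :* k := (x :+ con (+ 1)) :* k :+ (x :+ a) :* k) refl x a (κ * κ))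
            (0≤-* (0≤-+ (0≤-+ 0≤x 0≤x) (0≤1+a unit)) 0≤κ²)))))
        (<-respʳ-≈
          (solve 4 (λ D x a k →
             D :+ (((D :- (x :- con (+ 1)) :* k) :+ ((D :- k) :+ (D :- k)))
                   :+ (con (+ 1) :- a) :* k)
             := con (+ 4) :* D :- (x :+ a) :* k) refl D x a (κ * κ))
          (<-0≤-+ 0<D (0≤-+ [x+1]κ²≤3D (0≤-* (0≤1-a unit) 0≤κ²))))
        where
        x-1≈κ²+f : x - fromℕ 1 ≈ κ * κ + f
        x-1≈κ²+f = trans (+-congʳ x≈1+κ²+f)
          (solve 2 (λ k f → con (+ 1) :+ k :+ f :- con (+ 1) := k :+ f) refl (κ * κ) f)
        κ²≤D : 0≤ D - κ * κ
        κ²≤D = 0≤-resp-≈ (+-congʳ (sym D≈)) κ²≤distance²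
        [x-1]κ²≤D : 0≤ D - (x - fromℕ 1) * (κ * κ)
        [x-1]κ²≤D = 0≤-resp-≈
          (trans (+-cong (+-congʳ (sym D≈)) (*-congˡ f≈x-1-κ²))
            (solve 3 (λ D p k → (D :- p :* p) :+ p :* (p :- k) := D :- p :* k) refl D (x - fromℕ 1) (κ * κ)))
          (0≤-+ ([x-1]²≤distance² 0≤x)
            (0≤-* (0≤-resp-≈ (sym x-1≈κ²+f) (0≤-+ 0≤κ² 0≤f)) 0≤f))
          where
          f≈x-1-κ² : f ≈ (x - fromℕ 1) - κ * κ
          f≈x-1-κ² = trans (solve 2 (λ k f → f := (k :+ f) :- k) refl (κ * κ) f) (+-congʳ (sym x-1≈κ²+f))
        [x+1]κ²≤3D : 0≤ (D - (x - fromℕ 1) * (κ * κ)) + ((D - κ * κ) + (D - κ * κ))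
        [x+1]κ²≤3D = 0≤-+ [x-1]κ²≤D (0≤-+ κ²≤D κ²≤D)

      -- The two fractions add up to 2a(1 − x²)/(D⁺D⁻), where
      -- D⁺D⁻ = (x² − 1)² + 4x²b².
      odd-real-bound : ∀ {y⁺ y⁻ D⁺ D⁻} → D⁺ ≈ distance² a b x → D⁻ ≈ distance² a b (- x) →
        0# < D⁺ → 0# < D⁻ → y⁺ * D⁺ ≈ x + a → y⁻ * D⁻ ≈ - x + a → ∣ (y⁺ + y⁻) * (κ * κ) ∣< fromℕ 3
      odd-real-bound {y⁺} {y⁻} {D⁺} {D⁻} D⁺≈ D⁻≈ 0<D⁺ 0<D⁻ e⁺ e⁻ = quotient-bound 0<P numerator
        -- Since |a| ≤ 1 and s κ² ≤ P, the numerator satisfies |2 a s| κ² ≤ 2P; the third P gives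
        -- strictness.
        (<-respʳ-≈
          (solve 4 (λ P s k a → P :+ (((P :- s :* k) :+ (P :- s :* k)) :+ ((con (+ 1) :- a) :+ (con (+ 1) :- a)) :* (s :* k))
             := con (+ 3) :* P :+ :- (con (+ 2) :* a :* s) :* k) refl P s (κ * κ) a)
          (<-0≤-+ 0<P (0≤-+ (0≤-+ sκ²≤P sκ²≤P) (0≤-* (0≤-+ (0≤1-a unit) (0≤1-a unit)) (0≤-* 0≤s 0≤κ²)))))
        (<-respʳ-≈
          (solve 4 (λ P s k a → P :+ (((P :- s :* k) :+ (P :- s :* k)) :+ ((con (+ 1) :+ a) :+ (con (+ 1) :+ a)) :* (s :* k))
             := con (+ 3) :* P :- :- (con (+ 2) :* a :* s) :* k) refl P s (κ * κ) a)
          (<-0≤-+ 0<P (0≤-+ (0≤-+ sκ²≤P sκ²≤P) (0≤-* (0≤-+ (0≤1+a unit) (0≤1+a unit)) (0≤-* 0≤s 0≤κ²)))))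
        where
        P = D⁺ * D⁻
        0<P = *-pos 0<D⁺ 0<D⁻
        s = x * x - fromℕ 1

        D⁺≈′ : D⁺ ≈ x * x + fromℕ 2 * x * a + fromℕ 1
        D⁺≈′ = trans D⁺≈ (distance²-expand x)
        D⁻≈′ : D⁻ ≈ x * x - fromℕ 2 * x * a + fromℕ 1
        D⁻≈′ = trans D⁻≈ (trans (distance²-expand (- x))
          (solve 2 (λ x a → :- x :* :- x :+ con (+ 2) :* :- x :* a :+ con (+ 1)
                         := x :* x :- con (+ 2) :* x :* a :+ con (+ 1)) refl x a))

        numerator : (y⁺ + y⁻) * P ≈ - (fromℕ 2 * a * s)
        numerator = begin
          (y⁺ + y⁻) * (D⁺ * D⁻)
            ≈⟨ solve 4 (λ y z D E → (y :+ z) :* (D :* E) := y :* D :* E :+ z :* E :* D) refl y⁺ y⁻ D⁺ D⁻ ⟩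
          y⁺ * D⁺ * D⁻ + y⁻ * D⁻ * D⁺
            ≈⟨ +-cong (*-cong e⁺ D⁻≈′) (*-cong e⁻ D⁺≈′) ⟩
          (x + a) * (x * x - fromℕ 2 * x * a + fromℕ 1) + (- x + a) * (x * x + fromℕ 2 * x * a + fromℕ 1)
            ≈⟨ solve 2 (λ x a → (x :+ a) :* (x :* x :- con (+ 2) :* x :* a :+ con (+ 1))
                                  :+ (:- x :+ a) :* (x :* x :+ con (+ 2) :* x :* a :+ con (+ 1))
                              := :- (con (+ 2) :* a :* (x :* x :- con (+ 1)))) refl x a ⟩
          - (fromℕ 2 * a * s) ∎
          where open SetoidReasoning setoid

        0≤s-κ² : 0≤ s - κ * κ
        0≤s-κ² = 0≤-resp-≈
          (trans (solve 2 (λ κ e → (κ :+ κ) :+ e :* (con (+ 2) :+ (κ :+ κ) :+ e)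
                                := (con (+ 1) :+ κ :+ e) :* (con (+ 1) :+ κ :+ e) :- con (+ 1) :- κ :* κ) refl κ e)
            (+-congʳ (+-congʳ (*-cong (sym x≈1+κ+e) (sym x≈1+κ+e)))))
          (0≤-+ (0≤-+ 0≤κ 0≤κ) (0≤-* 0≤e (0≤-+ (0≤-+ (0≤fromℕ 2) (0≤-+ 0≤κ 0≤κ)) 0≤e)))

        0≤s : 0≤ s
        0≤s = 0≤-resp-≈ (solve 2 (λ s k → (s :- k) :+ k := s) refl s (κ * κ)) (0≤-+ 0≤s-κ² 0≤κ²)

        -- P - s κ² = s (s - κ²) + 4x² (1 - a)(1 + a), a sum of products of nonnegative factors.
        sκ²≤P : 0≤ P - s * (κ * κ)
        sκ²≤P = 0≤-resp-≈
          (trans (solve 3 (λ x a k →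
               (x :* x :- con (+ 1)) :* ((x :* x :- con (+ 1)) :- k) :+ con (+ 4) :* (x :* x) :* ((con (+ 1) :- a) :* (con (+ 1) :+ a))
               := (x :* x :+ con (+ 2) :* x :* a :+ con (+ 1)) :* (x :* x :- con (+ 2) :* x :* a :+ con (+ 1))
                    :- (x :* x :- con (+ 1)) :* k) refl x a (κ * κ))
            (+-congʳ (*-cong (sym D⁺≈′) (sym D⁻≈′))))
          (0≤-+ (0≤-* 0≤s 0≤s-κ²)
            (0≤-* (0≤-* (0≤fromℕ 4) ¬x²<0) (0≤-* (0≤1-a unit) (0≤1+a unit))))

-- Symmetric sums over the integers: linearity and summability.

module LatticeSums {c ℓ₁ ℓ₂} (ℝ : RealNumbers c ℓ₁ ℓ₂) where

  open RealNumbers ℝ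
  open RealProperties ℝ
  open Limits ℝ
  open QuadraticDecay ℝ
  open Circle ℝ
  open Series ℝ
  open RingProperties ring using (-‿distribˡ-*; -1*x≈-x)
  open CommutativeRing commutativeRing using (+-commutativeSemigroup)

  HasSum-cong : ∀ {f g L M} → (∀ k → f k ≈ g k) → L ≈ M → HasSum f L → HasSum g M
  HasSum-cong {f} {g} f≈g = ⟶-cong λ n → +-cong (f≈g (+ 0)) (partial n)
    where
    partial : ∀ n → sum< +-rawMonoid (λ k → f (+ suc k) + f -[1+ k ]) n
                  ≈ sum< +-rawMonoid (λ k → g (+ suc k) + g -[1+ k ]) n
    partial zero    = refl
    partial (suc n) = +-cong (partial n) (+-cong (f≈g (+ suc n)) (f≈g -[1+ n ]))

  HasSum-+ : ∀ {f g L M} → HasSum f L → HasSum g M → HasSum (λ k → f k + g k) (L + M)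
  HasSum-+ {f} {g} f-sum g-sum = ⟶-cong
    (λ n → trans (interchange _ _ _ _) (+-congˡ (partial n))) refl (⟶-+ f-sum g-sum)
    where
    open CommutativeSemigroupProperties +-commutativeSemigroup using (interchange)
    partial : ∀ n → sum< +-rawMonoid (λ k → f (+ suc k) + f -[1+ k ]) n
                  + sum< +-rawMonoid (λ k → g (+ suc k) + g -[1+ k ]) n
      ≈ sum< +-rawMonoid (λ k → (f (+ suc k) + g (+ suc k)) + (f -[1+ k ] + g -[1+ k ])) n
    partial zero    = +-identityˡ 0#
    partial (suc n) = trans (interchange _ _ _ _) (+-cong (partial n) (interchange _ _ _ _))

  HasSum-scale : ∀ {f L} x → HasSum f L → HasSum (λ k → x * f k) (x * L)
  HasSum-scale {f} x f-sum = ⟶-cong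
    (λ n → trans (distribˡ x _ _) (+-congˡ (partial n))) refl (⟶-scale x f-sum)
    where
    partial : ∀ n → x * sum< +-rawMonoid (λ k → f (+ suc k) + f -[1+ k ]) n
      ≈ sum< +-rawMonoid (λ k → x * f (+ suc k) + x * f -[1+ k ]) n
    partial zero    = zeroʳ x
    partial (suc n) = trans (distribˡ x _ _) (+-cong (partial n) (distribˡ x _ _))

  HasSum-neg : ∀ {f L} → HasSum f L → HasSum (λ k → - f k) (- L)
  HasSum-neg {f} f-sum = HasSum-cong {λ k → - 1# * f k} (λ _ → -1*x≈-x _) (-1*x≈-x _)
    (HasSum-scale {f} (- 1#) f-sum)

  -- Only the sum of the terms at k + 1 and -(k + 1) has to decay, as symmetric summation allows.
  -- The factor k² leaves the pair at 1 and -1 unconstrained.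
  quadratic-decay⇒summable : ∀ f {C} →
    (∀ k → ∣ (f (+ suc k) + f -[1+ k ]) * (fromℕ k * fromℕ k) ∣< C) → ∃[ S ] HasSum f S
  quadratic-decay⇒summable f bound = f (+ 0) + proj₁ L , ⟶-+ (⟶-const (f (+ 0))) (proj₂ L)
    where L = complete _ (quadratic-decay⇒cauchy _ bound)

  fromℕ-^ : ∀ m n → fromℕ m ^ n ≈ fromℕ (m ℕ.^ n)
  fromℕ-^ m zero    = sym (+-identityʳ 1#)
  fromℕ-^ m (suc n) = trans (*-congˡ (fromℕ-^ m n)) (sym (fromℕ-* m (m ℕ.^ n)))

  fromℕ-∸ : ∀ {m n} → m ℕ.≤ n → fromℕ n ≈ fromℕ m + fromℕ (n ℕ.∸ m)
  fromℕ-∸ {m} {n} m≤n = trans (reflexive (≡.cong fromℕ (≡.sym (ℕₚ.m+[n∸m]≡n m≤n)))) (fromℕ-+ m (n ℕ.∸ m))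

  -- Parity is recorded by its effect on signs. The disequalities travel with the induction so that
  -- an even positive exponent is known to be at least 2.
  EvenPower OddPower : ℕ → Set _
  EvenPower n = n ≢ 1 × (∀ x → (- x) ^ n ≈ x ^ n)
  OddPower n  = n ≢ 0 × (∀ x → (- x) ^ n ≈ - x ^ n)

  ^-parity : ∀ n → EvenPower n ⊎ OddPower n
  ^-parity zero = inj₁ ((λ ()) , λ _ → refl)
  ^-parity (suc n) with ^-parity n
  ... | inj₁ (_ , even)  = inj₂ ((λ ()) , λ x → trans (*-congˡ (even x)) (sym (-‿distribˡ-* x _)))
  ... | inj₂ (n≢0 , odd) = inj₁ ((λ { ≡.refl → n≢0 ≡.refl }) , λ x → trans (*-congˡ (odd x))
                             (solve 2 (λ x y → :- x :* :- y := x :* y) refl x (x ^ n)))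

  module Fractions (n : ℕ) .{{_ : NonZero n}} {a b} (unit : UnitVector a b)
           (D : ℤ → Carrier) (D≈ : ∀ k → D k ≈ distance² a b (fromℤ k ^ n)) (D#0 : ∀ k → D k # 0#) where

    0<D : ∀ k → 0# < D k
    0<D k = 0≤⇒pos (0≤-resp-≈ (sym (D≈ k)) (0≤-+ ¬x²<0 ¬x²<0)) (D#0 k)

    quotient : ∀ N k → N / D k ⟨ D#0 k ⟩ * D k ≈ N
    quotient N k = trans (solve 3 (λ N r D → N :* r :* D := N :* D :* r) refl N _ (D k))
      (recip-cancelʳ N (D k) (D#0 k))

    x : ℕ → Carrier
    x k = fromℤ (+ suc k) ^ n

    split : ∀ k {m} → suc m ℕ.≤ suc k ℕ.^ n → x k ≈ fromℕ 1 + fromℕ m + fromℕ (suc k ℕ.^ n ℕ.∸ suc m)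
    split k {m} m<x = trans (fromℕ-^ (suc k) n) (trans (fromℕ-∸ m<x) (+-congʳ (fromℕ-+ 1 m)))

    k<x : ∀ k → suc k ℕ.≤ suc k ℕ.^ n
    k<x k = ≡.subst (ℕ._≤ suc k ℕ.^ n) (ℕₚ.*-identityʳ (suc k)) (ℕₚ.^-monoʳ-≤ (suc k) (ℕ.>-nonZero⁻¹ n))

    k²<x : n ≢ 1 → ∀ k → suc (k ℕ.* k) ℕ.≤ suc k ℕ.^ n
    k²<x n≢1 k = begin
      suc (k ℕ.* k)         ≤⟨ ℕ.s≤s (ℕₚ.≤-trans (ℕₚ.*-monoʳ-≤ k (ℕₚ.n≤1+n k)) (ℕₚ.m≤n+m _ k)) ⟩
      suc k ℕ.* suc k       ≡⟨ ≡.cong (suc k ℕ.*_) (ℕₚ.*-identityʳ (suc k)) ⟨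
      suc k ℕ.^ 2           ≤⟨ ℕₚ.^-monoʳ-≤ (suc k) (ℕₚ.≤∧≢⇒< (ℕ.>-nonZero⁻¹ n) (n≢1 ∘ ≡.sym)) ⟩
      suc k ℕ.^ n           ∎
      where open ℕₚ.≤-Reasoning

    D⁺≈ : ∀ k → D (+ suc k) ≈ distance² a b (x k)
    D⁺≈ k = D≈ (+ suc k)

    0≤e : ∀ k → 0≤ fromℕ (suc k ℕ.^ n ℕ.∸ suc k)
    0≤e k = 0≤fromℕ (suc k ℕ.^ n ℕ.∸ suc k)

    realTerm imaginaryTerm : ℤ → Carrier
    realTerm k      = (fromℤ k ^ n + a) / D k ⟨ D#0 k ⟩
    imaginaryTerm k = b / D k ⟨ D#0 k ⟩

    imaginary-summable : ∃ (HasSum imaginaryTerm)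
    imaginary-summable = quadratic-decay⇒summable imaginaryTerm λ k → ∣∣<-resp-≈ (sym (distribʳ (fromℕ k * fromℕ k) _ _)) refl
      (∣∣<-+ (imaginary-bound unit (0≤fromℕ k) (0≤e k) (split k (k<x k)) (D⁺≈ k) (0<D (+ suc k)) (quotient b (+ suc k)))
        (negative k (^-parity n)))
      where
      negative : ∀ k → EvenPower n ⊎ OddPower n →
        ∣ b / D -[1+ k ] ⟨ D#0 -[1+ k ] ⟩ * (fromℕ k * fromℕ k) ∣< fromℕ 2
      negative k (inj₁ (_ , even)) = imaginary-bound unit (0≤fromℕ k) (0≤e k) (split k (k<x k))
        (trans (D≈ -[1+ k ]) (distance²-cong (even (fromℕ (suc k))))) (0<D -[1+ k ]) (quotient b -[1+ k ])
      -- For odd n the base is -x; this is traded for x with -a in place of a, again a point of the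
      -- unit circle.
      negative k (inj₂ (_ , odd)) = imaginary-bound (reflect unit) (0≤fromℕ k) (0≤e k) (split k (k<x k))
        (trans (D≈ -[1+ k ]) (trans (distance²-cong (odd (fromℕ (suc k)))) (distance²-neg a b (x k)))) (0<D -[1+ k ]) (quotient b -[1+ k ])

    real-summable : ∃ (HasSum realTerm)
    real-summable = summable (^-parity n)
      where
      summable : EvenPower n ⊎ OddPower n →
        ∃ (HasSum realTerm)
      -- Now n ≥ 2, so k² ≤ x - 1 and the two terms of a pair are bounded separately.
      summable (inj₁ (n≢1 , even)) = quadratic-decay⇒summable realTerm λ k → ∣∣<-resp-≈ (sym (distribʳ (fromℕ k * fromℕ k) _ _)) refl
        (∣∣<-+ (bound k {+ suc k} (D⁺≈ k) (quotient (x k + a) (+ suc k)))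
               (bound k { -[1+ k ] } (trans (D≈ -[1+ k ]) (distance²-cong (even (fromℕ (suc k))))) (trans (quotient (fromℤ -[1+ k ] ^ n + a) -[1+ k ]) (+-congʳ (even (fromℕ (suc k)))))))
        where
        bound : ∀ k {j y} → D j ≈ distance² a b (x k) → y * D j ≈ x k + a →
          ∣ y * (fromℕ k * fromℕ k) ∣< fromℕ 4
        bound k {j} D≈ yD≈ = real-bound unit (0≤fromℕ k) (0≤e k) (split k (k<x k)) (0≤fromℕ (suc k ℕ.^ n ℕ.∸ suc (k ℕ.* k)))
          (trans (split k (k²<x n≢1 k)) (+-congʳ (+-congˡ (fromℕ-* k k)))) D≈ (0<D j) yD≈
      summable (inj₂ (_ , odd)) = quadratic-decay⇒summable realTerm λ k →
        odd-real-bound unit (0≤fromℕ k) (0≤e k) (split k (k<x k)) (D⁺≈ k)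
          (trans (D≈ -[1+ k ]) (distance²-cong (odd (fromℕ (suc k))))) (0<D (+ suc k)) (0<D -[1+ k ])
          (quotient (x k + a) (+ suc k)) (trans (quotient (fromℤ -[1+ k ] ^ n + a) -[1+ k ]) (+-congʳ (odd (fromℕ (suc k)))))

-- The value of the series on the unit circle.

module Evaluation {c ℓ₁ ℓ₂} (ℝ : RealNumbers c ℓ₁ ℓ₂) where

  open RealNumbers ℝ
  open RealProperties ℝ
  open Trigonometry ℝ
  open Complex ℝ
  open Series ℝ
  open Limits ℝ
  open ComplexExponential ℝ
  open DeMoivre ℝ
  open Circle ℝ
  open LatticeSums ℝ
  open SemiringExp semiring using (^-homo-*)
  open RingProperties ring using (-‿distribˡ-*)

  -- With tolerance ε/2 for each part, the squared modulus stays below 2 (ε/2)² = ε²/2 < ε².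
  ⟶̂⇒⟶ℂ : ∀ {s L} → s ⟶̂ L → s ⟶ℂ L
  ⟶̂⇒⟶ℂ {s} {L} (re⟶ , im⟶) ε 0<ε = M ℕ.⊔ N , λ n M⊔N≤n → <-trans
    (+-mono-< (square (proj₂ re-near n (ℕₚ.m⊔n≤o⇒m≤o M N M⊔N≤n)))
              (square (proj₂ im-near n (ℕₚ.m⊔n≤o⇒n≤o M N M⊔N≤n))))
    (by-difference (*-pos 0<h (*-pos 0<ε 0<ε)) (trans
      (solve 2 (λ h ε → h :* (ε :* ε) := (h :+ h) :* (ε :* ε) :- h :* (ε :* ε)) refl h ε)
      (+-cong (trans (*-congʳ h+h≈1) (*-identityˡ _)) (-‿cong half))))
    where
    re-near = re⟶ (h * ε) (*-pos 0<h 0<ε)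
    im-near = im⟶ (h * ε) (*-pos 0<h 0<ε)
    M = proj₁ re-near
    N = proj₁ im-near
    square : ∀ {x} → ∣ x ∣< h * ε → x * x < (h * ε) * (h * ε)
    square p = proj₂ (∣∣<-* p p)
    half : h * (ε * ε) ≈ (h * ε) * (h * ε) + (h * ε) * (h * ε)
    half = trans (sym (trans (*-congʳ h+h≈1) (*-identityˡ _)))
      (solve 2 (λ h ε → (h :+ h) :* (h :* (ε :* ε)) := (h :* ε) :* (h :* ε) :+ (h :* ε) :* (h :* ε)) refl h ε)

  HasSumℂ-components : ∀ {f x y} → HasSum (re ∘ f) x → HasSum (im ∘ f) y → HasSumℂ f (x +i y)
  HasSumℂ-components {f} p q = ⟶̂⇒⟶ℂ
    ( ⟶-cong (λ n → +-congˡ (reflexive (≡.sym (re-∑ _ n)))) refl p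
    , ⟶-cong (λ n → +-congˡ (reflexive (≡.sym (im-∑ _ n)))) refl q)
    where open Convolution ℂ-commutativeSemiring

  -- A reciprocal is extracted from an apartness proof; cancelling y shows that its value depends
  -- neither on that proof nor on the representative of y.
  /-cong : ∀ {x x′ y y′} (y#0 : y # 0#) (y′#0 : y′ # 0#) → x ≈ x′ → y ≈ y′ → x / y ⟨ y#0 ⟩ ≈ x′ / y′ ⟨ y′#0 ⟩
  /-cong {x} {x′} {y} {y′} y#0 y′#0 x≈x′ y≈y′ = *-cong x≈x′ (*-cancelʳ y#0 (begin
    recip y y#0 * y      ≈⟨ trans (*-comm _ _) (recip-inverseʳ y y#0) ⟩
    1#                   ≈⟨ trans (*-comm _ _) (recip-inverseʳ y′ y′#0) ⟨
    recip y′ y′#0 * y′   ≈⟨ *-congˡ y≈y′ ⟨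
    recip y′ y′#0 * y    ∎))
    where open SetoidReasoning setoid

  ofℝ-^ : ∀ x n → (ofℝ x ^ℂ n) ≈ℂ ofℝ (x ^ n)
  ofℝ-^ x zero    = refl , refl
  ofℝ-^ x (suc n) = ℂ+*.trans (ofℝ-* x (ofℝ x ^ℂ n))
    (*-congˡ (proj₁ (ofℝ-^ x n)) , trans (*-congˡ (proj₂ (ofℝ-^ x n))) (zeroʳ x))

  module UnitCircle (n : ℕ) .{{_ : NonZero n}} (θ : Carrier) (nonPole : NonPole n (e^i θ)) where

    nθ = fromℕ n * θ
    D  = denominator n θ
    a  = cos nθ
    b  = sin nθ

    w : ℤ → ℂ
    w k = ofℝ (fromℤ k) ^ℂ n +ℂ (e^i θ) ^ℂ n

    w≈ : ∀ k → w k ≈ℂ (fromℤ k ^ n + a +i b)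
    w≈ k = ℂ+*.trans (ℂ+*.+-cong (ofℝ-^ (fromℤ k) n) (deMoivre θ n)) (refl , +-identityˡ b)

    unit : UnitVector a b
    unit = trans (cos²+sin²≈1 nθ) (sym (+-identityʳ 1#))

    D≈distance² : ∀ k → D k ≈ distance² a b (fromℤ k ^ n)
    D≈distance² k = begin
      x ^ (n ℕ.+ (n ℕ.+ 0)) + fromℕ 2 * x ^ n * a + 1#
        ≈⟨ +-congʳ (+-congʳ (trans (^-homo-* x n (n ℕ.+ 0))
             (*-congˡ (reflexive (≡.cong (x ^_) (ℕₚ.+-identityʳ n)))))) ⟩
      x ^ n * x ^ n + fromℕ 2 * x ^ n * a + 1#
        ≈⟨ +-congˡ (cos²+sin²≈1 nθ) ⟨
      x ^ n * x ^ n + fromℕ 2 * x ^ n * a + (a * a + b * b)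
        ≈⟨ solve 3 (λ x a b → x :* x :+ con (+ 2) :* x :* a :+ (a :* a :+ b :* b)
                           := (x :+ a) :* (x :+ a) :+ b :* b) refl (x ^ n) a b ⟩
      distance² a b (x ^ n) ∎
      where
      open SetoidReasoning setoid
      x = fromℤ k

    ∣w∣²≈D : ∀ k → ∣ w k ∣² ≈ D k
    ∣w∣²≈D k = trans
      (+-cong (*-cong (proj₁ (w≈ k)) (proj₁ (w≈ k))) (*-cong (proj₂ (w≈ k)) (proj₂ (w≈ k))))
      (sym (D≈distance² k))

    D#0 : ∀ k → D k # 0#
    D#0 k = #-congʳ (∣w∣²≈D k) (∣ nonPole k ∣²#0)

    open Fractions n unit D D≈distance² D#0 using (realTerm; imaginaryTerm)
      renaming (real-summable to real; imaginary-summable to imaginary) public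

    Uₙ : ℂ
    Uₙ = proj₁ real +i - proj₁ imaginary

    isU : IsU n (e^i θ) nonPole Uₙ
    isU = HasSumℂ-components {f}
      (HasSum-cong {realTerm} {re ∘ f}
        (λ k → sym (/-cong ∣ nonPole k ∣²#0 (D#0 k) (proj₁ (w≈ k)) (∣w∣²≈D k)))
        refl (proj₂ real))
      (HasSum-cong {λ k → - imaginaryTerm k} {im ∘ f}
        (λ k → trans (-‿distribˡ-* b _)
          (sym (/-cong ∣ nonPole k ∣²#0 (D#0 k) (-‿cong (proj₂ (w≈ k))) (∣w∣²≈D k))))
        refl (HasSum-neg {imaginaryTerm} (proj₂ imaginary)))
      where
      f : ℤ → ℂ
      f k = recipℂ (w k) (nonPole k)

    -- The cotangent q satisfies a - q b = 0, so (x + a)/D - q b/D = x/D term by term, and linearity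
    -- of symmetric sums does the rest.
    cot-identity : (b#0 : b # 0#) →
      HasSum (λ k → fromℤ k ^ n / D k ⟨ D#0 k ⟩) (re Uₙ + cot nθ b#0 * im Uₙ)
    cot-identity b#0 = HasSum-cong {λ k → realTerm k + - q * imaginaryTerm k}
      (λ k → trans
        (solve 5 (λ x a b q r → (x :+ a) :* r :+ :- q :* (b :* r) := x :* r :+ (a :- q :* b) :* r) refl
          (fromℤ k ^ n) a b q (recip (D k) (D#0 k)))
        (trans (+-congˡ (trans (*-congʳ a-cot*b≈0) (zeroˡ _))) (+-identityʳ _)))
      (solve 3 (λ R q I → R :+ :- q :* I := R :+ q :* :- I) refl (proj₁ real) q (proj₁ imaginary))
      (HasSum-+ {realTerm} {λ k → - q * imaginaryTerm k} (proj₂ real)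
        (HasSum-scale {imaginaryTerm} (- q) (proj₂ imaginary)))
      where
      q = cot nθ b#0
      a-cot*b≈0 : a - cot nθ b#0 * b ≈ 0#
      a-cot*b≈0 = trans (+-congˡ (-‿cong (trans
        (solve 3 (λ a b r → a :* r :* b := a :* b :* r) refl a b (recip b b#0)) (recip-cancelʳ a b b#0)))) (-‿inverseʳ a)

corollary2p2 :
    ∀ {c ℓ₁ ℓ₂} (ℝ : RealNumbers c ℓ₁ ℓ₂) →
    let open RealNumbers ℝ
        open RealProperties ℝ
        open Trigonometry ℝ
        open Complex ℝ
        open Series ℝ
    in
    (n : ℕ) .{{_ : NonZero n}} (θ : Carrier) (nonPole : NonPole n (e^i θ)) →
    let nθ = fromℕ n * θ
        D  = denominator n θ
    in
    Σ[ Uₙ ∈ ℂ ] IsU n (e^i θ) nonPole Uₙ ×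
    (Σ[ D#0 ∈ (∀ k → D k # 0#) ]
      HasSum (λ k → (fromℤ k ^ n + cos nθ) / D k ⟨ D#0 k ⟩) (re Uₙ) ×
      (∃[ S ] HasSum (λ k → sin nθ / D k ⟨ D#0 k ⟩) S × im Uₙ ≈ - S) ×
      ((sin#0 : sin nθ # 0#) →
        HasSum (λ k → fromℤ k ^ n / D k ⟨ D#0 k ⟩) (re Uₙ + cot nθ sin#0 * im Uₙ)))
corollary2p2 ℝ n θ nonPole =
  Uₙ , isU , D#0 , proj₂ real , (proj₁ imaginary , proj₂ imaginary , refl) , cot-identity
  where
  open RealNumbers ℝ using (refl)
  open Evaluation ℝ
  open UnitCircle n θ nonPole
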